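{- Let $f$ be a positive integer-valued function on the positive integers satisfying $f(n)=o(n)$, let $t\geq1$ be a fixed integer, and assume that $n$ is sufficiently large. Set $P_n=\lceil n/3-10f(n)\rceil$. If every $f(n)$-vertex subgraph of the Kneser graph $KG(P_n,21f(n))$ is $t$-colorable, then every $n$-vertex $K_3$-free graph with minimum degree at least $\frac{1}{3}n-f(n)$ is $(t+10^{391})$-colorable.
   Context: All graphs are finite and simple. For positive integers $m,k$, the Kneser graph $KG(m,k)$ has as vertex set the collection of all $m$-element subsets of $\{1,\dots,2m+k\}$, two vertices being adjacent if and only if the corresponding subsets are disjoint (often denoted $KG(2m+k,m)$). An $m$-vertex subgraph is a subgraph with exactly $m$ vertices. -}

module Defs where

open import Data.Fin using (Fin)
import Data.Fin as Fin
import Data.Fin.Properties as Fin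
open import Data.Fin.Subset using (Subset; inside; outside; ⊥; ∣_∣; _∩_; Empty)
open import Data.Fin.Subset.Properties using (∩-comm; ∩-idem; nonempty?; Empty-unique; ∣⊥∣≡0)
open import Data.Integer using (+_)
open import Data.List using (List; length; filter; map; allFin)
open import Data.Nat using (ℕ; zero; suc; _+_; _*_; _≤_; z≤n; NonZero; ≢-nonZero⁻¹)
open import Data.Nat.Combinatorics using (_C_; nCn≡1; nCk≡nC[n∸k]; nCk+nC[k+1]≡[n+1]C[k+1])
open import Data.Nat.Properties using (≡-irrelevant; suc-injective)
open import Data.Product using (Σ-syntax; ∃-syntax; _,_; proj₁)
open import Data.Rational as ℚ using (ℚ; 0ℚ)
open import Data.Sum using (_⊎_; inj₁; inj₂)
open import Data.Sum.Function.Propositional using (_⊎-↔_)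
open import Data.Vec using ([]; _∷_)
open import Function using (_↔_; mk↔ₛ′; Inverse; Injective)
open import Function.Construct.Composition using (_↔-∘_)
open import Function.Construct.Identity using (↔-id)
open import Function.Construct.Symmetry using (↔-sym)
open import Relation.Binary using (Decidable; Irreflexive; Symmetric)
open import Relation.Binary.PropositionalEquality
  using (_≡_; _≢_; refl; sym; trans; cong; subst; ≢-sym)
open import Relation.Nullary using (¬_; ¬?)

-- Finite simple graphs.  Adjacency is a decidable relation, which is automatic
-- classically and is what makes degrees computable here.
record Graph : Set₁ where
  field
    Vertex     : Set
    Adj        : Vertex → Vertex → Set
    Adj-irrefl : Irreflexive _≡_ Adj
    Adj-sym    : Symmetric Adj
    Adj?       : Decidable Adj
    order      : ℕ
    enumerate  : Vertex ↔ Fin order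

  vertices : List Vertex
  vertices = map (Inverse.from enumerate) (allFin order)

  degree : Vertex → ℕ
  degree v = length (filter (Adj? v) vertices)

open Graph

-- Subgraphs are taken up to isomorphism and need not be induced: the
-- injection plays the role of the inclusion V(H) ⊆ V(G), and adjacency is only
-- required to be preserved (E(H) ⊆ E(G)).
record _IsSubgraphOf_ (H G : Graph) : Set where
  field
    embed     : Vertex H → Vertex G
    injective : Injective _≡_ _≡_ embed
    preserves : ∀ {u v} → Adj H u v → Adj G (embed u) (embed v)

Colorable : ℕ → Graph → Set
Colorable t G =
  Σ[ c ∈ (Vertex G → Fin t) ] (∀ {u v} → Adj G u v → c u ≢ c v)

K : ℕ → Graph
K r = record
  { Vertex     = Fin r
  ; Adj        = _≢_
  ; Adj-irrefl = λ eq neq → neq eq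
  ; Adj-sym    = ≢-sym
  ; Adj?       = λ u v → ¬? (u Fin.≟ v)
  ; order      = r
  ; enumerate  = ↔-id (Fin r)
  }

_-Free : Graph → Graph → Set
(F -Free) G = ¬ (F IsSubgraphOf G)

fromℕ : ℕ → ℚ
fromℕ n = + n ℚ./ 1

MinDegreeAtLeast : ℚ → Graph → Set
MinDegreeAtLeast d G = ∀ v → d ℚ.≤ fromℕ (degree G v)

-- f(n) = o(n); restricting ε to rationals does not change the notion.
IsLittleO-id : (ℕ → ℕ) → Set
IsLittleO-id f =
  ∀ (ε : ℚ) → 0ℚ ℚ.< ε →
  ∃[ N ] (∀ n → N ≤ n → fromℕ (f n) ℚ.≤ ε ℚ.* fromℕ n)

SubsetOfSize : ℕ → ℕ → Set
SubsetOfSize N m = Σ[ s ∈ Subset N ] ∣ s ∣ ≡ m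

subsetOfSize-≡ : ∀ {N m} {s t : SubsetOfSize N m} → proj₁ s ≡ proj₁ t → s ≡ t
subsetOfSize-≡ {s = s , p} {t = .s , q} refl = cong (s ,_) (≡-irrelevant p q)

pascal-↔ : ∀ N m →
  SubsetOfSize (suc N) (suc m) ↔ (SubsetOfSize N m ⊎ SubsetOfSize N (suc m))
pascal-↔ N m = mk↔ₛ′ to from to∘from from∘to
  where
  to : SubsetOfSize (suc N) (suc m) → SubsetOfSize N m ⊎ SubsetOfSize N (suc m)
  to (inside  ∷ s , p) = inj₁ (s , suc-injective p)
  to (outside ∷ s , p) = inj₂ (s , p)
  from : SubsetOfSize N m ⊎ SubsetOfSize N (suc m) → SubsetOfSize (suc N) (suc m)
  from (inj₁ (s , p)) = inside ∷ s , cong suc p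
  from (inj₂ (s , p)) = outside ∷ s , p
  to∘from : ∀ x → to (from x) ≡ x
  to∘from (inj₁ _) = cong inj₁ (subsetOfSize-≡ refl)
  to∘from (inj₂ _) = refl
  from∘to : ∀ x → from (to x) ≡ x
  from∘to (inside  ∷ s , p) = subsetOfSize-≡ refl
  from∘to (outside ∷ s , p) = refl

size0⇒empty : ∀ {N} (s : Subset N) → ∣ s ∣ ≡ 0 → s ≡ ⊥
size0⇒empty []            _ = refl
size0⇒empty (outside ∷ s) p = cong (outside ∷_) (size0⇒empty s p)

emptySubset-↔ : ∀ N → SubsetOfSize N 0 ↔ Fin 1
emptySubset-↔ N = mk↔ₛ′
  (λ _ → Fin.zero)
  (λ _ → ⊥ , ∣⊥∣≡0 N)
  (λ { Fin.zero → refl ; (Fin.suc ()) })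
  (λ { (s , p) → subsetOfSize-≡ (sym (size0⇒empty s p)) })

subsetsOfSize-↔ : ∀ N m → SubsetOfSize N m ↔ Fin (N C m)
subsetsOfSize-↔ N zero =
  subst (λ c → SubsetOfSize N 0 ↔ Fin c)
    (sym (trans (nCk≡nC[n∸k] {n = N} z≤n) (nCn≡1 N)))
    (emptySubset-↔ N)
subsetsOfSize-↔ zero (suc m) =
  mk↔ₛ′ (λ { ([] , ()) }) (λ ()) (λ ()) (λ { ([] , ()) })
subsetsOfSize-↔ (suc N) (suc m) =
  subst (λ c → SubsetOfSize (suc N) (suc m) ↔ Fin c)
    (nCk+nC[k+1]≡[n+1]C[k+1] N m)
    (↔-sym Fin.+↔⊎
      ↔-∘ ((subsetsOfSize-↔ N m ⊎-↔ subsetsOfSize-↔ N (suc m))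
      ↔-∘ pascal-↔ N m))

-- m must be positive: the empty set is disjoint from itself, so for m = 0 the
-- disjointness relation would have a loop.
KG : (m k : ℕ) → .{{_ : NonZero m}} → Graph
KG m k = record
  { Vertex     = SubsetOfSize (2 * m + k) m
  ; Adj        = λ (s , _) (t , _) → Empty (s ∩ t)
  ; Adj-irrefl = λ { {s , p} refl e → ≢-nonZero⁻¹ m (trans (sym p) (empty⇒size0 s e)) }
  ; Adj-sym    = λ {(s , _)} {(t , _)} e → subst Empty (∩-comm s t) e
  ; Adj?       = λ (s , _) (t , _) → ¬? (nonempty? (s ∩ t))
  ; order      = (2 * m + k) C m
  ; enumerate  = subsetsOfSize-↔ (2 * m + k) m
  }
  where
  empty⇒size0 : ∀ {N} (s : Subset N) → Empty (s ∩ s) → ∣ s ∣ ≡ 0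
  empty⇒size0 {N} s e =
    trans (cong ∣_∣ (Empty-unique (subst Empty (∩-idem s) e))) (∣⊥∣≡0 N)

{-# OPTIONS --safe #-}

-- All degrees are at least d = P + 9f, and 3d ≤ n ≤ 3d + 3f.
--
-- Suppose some vertex z has degree above 5n/9 + 10f/3.  The set X of vertices without
-- neighbours in N(z) is independent.  Let Y be its complement and s = |Y| - d.  Every x in X
-- misses at most s vertices of Y, every y in Y has at most s neighbours in Y, and so at least
-- d - s in X; counting then shows that Y has no closed walk of length 5.  If s ≤ 9f, every
-- y in Y has P neighbours in X and |X| ≤ 2P + 21f.  Removing six sets N(x), x in X, leaves at
-- most f vertices of Y, and sending y to P of its neighbours in X maps them to a Kneser graph.
-- If s > 9f, the y in Y with at most s/3 neighbours in Y are independent, at most four of the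
-- others have pairwise disjoint neighbourhoods in Y, and those whose neighbourhood in Y meets a
-- given one are independent as Y has no closed 5-walk.
--
-- Otherwise all degrees are at most about 5n/9, which forces many edges between N(u) and N(v)
-- for every edge uv.  With E the ±1 adjacency matrix and q = 1_{N(u)} - 1_{N(v)}, this makes
-- the vector E q long.  Quantise the inner products of the vectors E 1_{N(x)} with E q for a
-- list of edges; an edge inside a colour class extends the list by a vector almost orthogonal
-- to the previous ones.  Since E has Frobenius norm n, the list has at most 90 members.

module Submission where

open import Algebra.Bundles using (CommutativeRing)
open import Data.Bool using (Bool; true; false; not; _∧_; _∨_; if_then_else_)
import Data.Bool as Bool
open import Data.Bool.Properties using (¬-not)
open import Data.Empty using (⊥; ⊥-elim)
open import Data.Fin using (Fin; zero; suc; toℕ; inject₁; inject≤; combine; _↑ˡ_; _↑ʳ_)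
import Data.Fin as Fin
open import Data.Fin.Properties
  using (any?; combine-injective; inject≤-injective; ↑ˡ-injective; ↑ʳ-injective; splitAt-↑ˡ; splitAt-↑ʳ)
import Data.Fin.Properties as Fin
open import Data.Fin.Subset using (Subset; ∣_∣; _∩_; Empty)
import Data.Fin.Subset as Subset
import Data.Fin.Subset.Properties as Subset
open import Data.Integer using (ℤ; +_; -[1+_]; +[1+_]; 0ℤ; 1ℤ; +≤+; -≤+; +<+)
import Data.Integer as ℤ
import Data.Integer.Properties as ℤ
open import Data.Integer.DivMod using (a≡a%n+[a/n]*n; n%d<d)
open import Data.Integer.Tactic.RingSolver using (solve-∀)
open import Data.List using (List; []; _∷_; length; map; filter; tabulate)
open import Data.List.Properties using (length-map; map-tabulate)
open import Data.List.Relation.Unary.All as All using (All; []; _∷_)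
open import Data.List.Relation.Unary.AllPairs as AllPairs using (AllPairs; []; _∷_)
import Data.List.Relation.Unary.AllPairs.Properties as AllPairs
open import Data.Nat as ℕ using (ℕ; zero; suc; z≤n; s≤s; z<s; NonZero)
open import Data.Nat.Combinatorics using (_C_; nCn≡1; nCk≡nC[n∸k]; nCk+nC[k+1]≡[n+1]C[k+1])
import Data.Nat.Properties as ℕ
open import Data.Product using (∃-syntax; Σ-syntax; _×_; _,_; proj₁; proj₂)
open import Data.Rational as ℚ using (0ℚ; ↥_; ↧_; toℚᵘ)
import Data.Rational.Properties as ℚ
open import Data.Rational.Unnormalised as ℚᵘ using (mkℚᵘ)
import Data.Rational.Unnormalised.Properties as ℚᵘ
open import Data.Sum using (_⊎_; inj₁; inj₂)
open import Data.Vec using ([]; _∷_; there)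
open import Function using (_∘_; case_of_; Inverse; Injective)
open import Function.Construct.Identity using (↔-id)
open import Relation.Binary.PropositionalEquality
open import Relation.Nullary using (yes; no; ¬_; does)
open import Relation.Nullary.Decidable using (_×-dec_; dec-true; toWitness)
open import Relation.Unary using (Decidable)
open import Defs

module Development where
  open import Data.Integer using (_+_; _-_; _*_; -_; _≤_; _<_; _<?_; _≤?_; positive)
  open import Data.Integer.Properties
  import Algebra.Properties.Semiring.Sum (CommutativeRing.semiring +-*-commutativeRing) as Sum

  -- Sums and inequalities over the integers

  -- Inequalities are certified by writing right minus left as a combination of
  -- nonnegative terms, which leaves a ring identity.

  by : ∀ {a b e} → 0ℤ ≤ e → e ≡ b - a → a ≤ b
  by p refl = 0≤i-j⇒j≤i p

  -- Contradictions are certified in the same way: the hypotheses are combined with nonnegative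
  -- weights until everything cancels except `- 1`.
  absurdBy : ∀ {e} → 0ℤ ≤ e → e ≡ - 1ℤ → ⊥
  absurdBy () refl

  gap : ∀ {a b} → a ≤ b → 0ℤ ≤ b - a
  gap = i≤j⇒0≤j-i

  gap< : ∀ {a b} → a < b → 0ℤ ≤ b - (1ℤ + a)
  gap< p = gap (i<j⇒suc[i]≤j p)

  infixl 6 _⊕_
  infixl 7 _⊗_ _·_

  _⊕_ : ∀ {a b} → 0ℤ ≤ a → 0ℤ ≤ b → 0ℤ ≤ a + b
  _⊕_ = +-mono-≤

  _⊗_ : ∀ {a b} → 0ℤ ≤ a → 0ℤ ≤ b → 0ℤ ≤ a * b
  _⊗_ {+ a} {+ b} _ _ = subst (_≤_ 0ℤ) (pos-* a b) (+≤+ z≤n)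
  _⊗_ {+ a} { -[1+ b ]} _ ()

  _·_ : ∀ (c : ℕ) {a} → 0ℤ ≤ a → 0ℤ ≤ + c * a
  c · p = +≤+ (z≤n {c}) ⊗ p

  square≥0 : ∀ a → 0ℤ ≤ a * a
  square≥0 (+ a) = +≤+ (z≤n {a}) ⊗ +≤+ (z≤n {a})
  square≥0 -[1+ a ] = +≤+ z≤n

  halve : ∀ {a b} → + 2 * a ≤ + 2 * b → a ≤ b
  halve p = *-cancelˡ-≤-pos _ _ (+ 2) p

  0≤+ : ∀ {k} → 0ℤ ≤ + k
  0≤+ = +≤+ z≤n

  -- The mixed terms cancel in `(A - a)(b + B) + (a + A)(B - b)`, which avoids a case distinction on
  -- signs.
  product-bound : ∀ {a b A B} → - A ≤ a → a ≤ A → - B ≤ b → b ≤ B → a * b ≤ A * B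
  product-bound {a} {b} {A} {B} -A≤a a≤A -B≤b b≤B =
    halve (by (gap a≤A ⊗ gap -B≤b ⊕ gap -A≤a ⊗ gap b≤B) (certificate a b A B))
    where
    certificate : ∀ a b A B → (A - a) * (b - - B) + (a - - A) * (B - b) ≡ + 2 * (A * B) - + 2 * (a * b)
    certificate = solve-∀

  opaque
    ∑ : ∀ {n} → (Fin n → ℤ) → ℤ
    ∑ = Sum.sum

    ∑-distrib-+ : ∀ {n} (f g : Fin n → ℤ) → ∑ (λ i → f i + g i) ≡ ∑ f + ∑ g
    ∑-distrib-+ = Sum.∑-distrib-+

    ∑-comm : ∀ {m n} (f : Fin m → Fin n → ℤ) →
      ∑ (λ i → ∑ λ j → f i j) ≡ ∑ (λ j → ∑ λ i → f i j)
    ∑-comm = Sum.∑-comm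

    ∑-cong : ∀ {n} {f g : Fin n → ℤ} → (∀ i → f i ≡ g i) → ∑ f ≡ ∑ g
    ∑-cong = Sum.sum-cong-≗

    ∑-mono : ∀ {n} {f g : Fin n → ℤ} → (∀ i → f i ≤ g i) → ∑ f ≤ ∑ g
    ∑-mono {zero}  p = ≤-refl
    ∑-mono {suc n} p = +-mono-≤ (p zero) (∑-mono (p ∘ suc))

    ∑-*ˡ : ∀ {n} c (f : Fin n → ℤ) → ∑ (λ i → c * f i) ≡ c * ∑ f
    ∑-*ˡ c f = sym (Sum.*-distribˡ-sum c f)

    ∑-*ʳ : ∀ {n} c (f : Fin n → ℤ) → ∑ (λ i → f i * c) ≡ ∑ f * c
    ∑-*ʳ c f = trans (∑-cong λ i → *-comm (f i) c) (trans (∑-*ˡ c f) (*-comm c (∑ f)))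

    ∑-neg : ∀ {n} (f : Fin n → ℤ) → ∑ (λ i → - f i) ≡ - ∑ f
    ∑-neg {zero}  f = refl
    ∑-neg {suc n} f = trans (cong (_+_ (- f zero)) (∑-neg (f ∘ suc))) (sym (neg-distrib-+ (f zero) _))

    ∑-distrib-- : ∀ {n} (f g : Fin n → ℤ) → ∑ (λ i → f i - g i) ≡ ∑ f - ∑ g
    ∑-distrib-- f g = trans (∑-distrib-+ f (-_ ∘ g)) (cong (_+_ (∑ f)) (∑-neg g))

    ∑-const : ∀ n c → ∑ {n} (λ _ → c) ≡ + n * c
    ∑-const zero    c = sym (*-zeroˡ c)
    ∑-const (suc n) c = trans (cong (_+_ c) (∑-const n c)) (sym (suc-* (+ n) c))

  ∑-nonneg : ∀ {n} {f : Fin n → ℤ} → (∀ i → 0ℤ ≤ f i) → 0ℤ ≤ ∑ f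
  ∑-nonneg {n} p = ≤-trans (≤-reflexive (sym (trans (∑-const n 0ℤ) (*-zeroʳ (+ n))))) (∑-mono p)

  ∑-product : ∀ {m n} (f : Fin m → ℤ) (g : Fin n → ℤ) →
    ∑ (λ i → ∑ λ j → f i * g j) ≡ ∑ f * ∑ g
  ∑-product f g = trans (∑-cong λ i → ∑-*ˡ (f i) g) (∑-*ʳ (∑ g) f)

  ⟦_⟧ : Bool → ℤ
  ⟦ true  ⟧ = 1ℤ
  ⟦ false ⟧ = 0ℤ

  ⟦⟧≥0 : ∀ b → 0ℤ ≤ ⟦ b ⟧
  ⟦⟧≥0 true  = +≤+ z≤n
  ⟦⟧≥0 false = +≤+ z≤n

  ⟦⟧≤1 : ∀ b → ⟦ b ⟧ ≤ 1ℤ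
  ⟦⟧≤1 true  = ≤-refl
  ⟦⟧≤1 false = +≤+ z≤n

  size : ∀ {n} → (Fin n → Bool) → ℤ
  size S = ∑ λ i → ⟦ S i ⟧

  size-mono : ∀ {n} {S T : Fin n → Bool} → (∀ i → S i ≡ true → T i ≡ true) → size S ≤ size T
  size-mono {S = S} {T} S⊆T = ∑-mono pointwise
    where
    pointwise : ∀ i → ⟦ S i ⟧ ≤ ⟦ T i ⟧
    pointwise i with S i in eq
    ... | false = ⟦⟧≥0 (T i)
    ... | true rewrite S⊆T i eq = ≤-refl

  size≥0 : ∀ {n} (S : Fin n → Bool) → 0ℤ ≤ size S
  size≥0 S = ∑-nonneg (⟦⟧≥0 ∘ S)

  cancel-suc : ∀ a b → 1ℤ + a - (1ℤ + b) ≡ a - b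
  cancel-suc = solve-∀

  opaque
    unfolding ∑

    -- Trims neighbourhoods to a common size, and later supplies the P-element sets that are
    -- vertices of the Kneser graph.
    subsetOfSize : ∀ {n} (S : Fin n → Bool) d → + d ≤ size S →
      ∃[ T ] (∀ i → T i ≡ true → S i ≡ true) × size {n} T ≡ + d
    subsetOfSize {n} S zero _ = (λ _ → false) , (λ _ ()) , trans (∑-const n 0ℤ) (*-zeroʳ (+ n))
    subsetOfSize {zero} S (suc d) (+≤+ ())
    subsetOfSize {suc n} S (suc d) d≤ with S zero in eq
    ... | false with T , T⊆S , |T| ← subsetOfSize (S ∘ suc) (suc d) (subst (_≤_ (+ suc d)) (+-identityˡ _) d≤)
        = T′ , (λ { zero () ; (suc i) → T⊆S i }) , trans (+-identityˡ _) |T|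
      where
      T′ : Fin (suc n) → Bool
      T′ zero    = false
      T′ (suc i) = T i
    ... | true with T , T⊆S , |T| ← subsetOfSize (S ∘ suc) d
                    (by (gap d≤) (cancel-suc (size (S ∘ suc)) (+ d)))
        = T′ , (λ { zero _ → eq ; (suc i) → T⊆S i }) , cong (_+_ 1ℤ) |T|
      where
      T′ : Fin (suc n) → Bool
      T′ zero    = true
      T′ (suc i) = T i

  -- Almost orthogonal families of vectors

  module _ {n : ℕ} where
    Vector : Set
    Vector = Fin n → ℤ

    ⟨_,_⟩ : Vector → Vector → ℤ
    ⟨ x , y ⟩ = ∑ λ i → x i * y i

    ⟨⟩-comm : ∀ x y → ⟨ x , y ⟩ ≡ ⟨ y , x ⟩
    ⟨⟩-comm x y = ∑-cong λ i → *-comm (x i) (y i)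

    ⟨⟩-distribˡ-- : ∀ x y z → ⟨ x , (λ i → y i - z i) ⟩ ≡ ⟨ x , y ⟩ - ⟨ x , z ⟩
    ⟨⟩-distribˡ-- x y z =
      trans (∑-cong λ i → *-distribˡ-- (x i) (y i) (z i))
            (∑-distrib-- (λ i → x i * y i) (λ i → x i * z i))
      where
      *-distribˡ-- : ∀ a b c → a * (b - c) ≡ a * b - a * c
      *-distribˡ-- = solve-∀

    Matrix : Set
    Matrix = Fin n → Vector

    ∑∑ : Matrix → ℤ
    ∑∑ A = ∑ λ i → ∑ (A i)

    ∑∑-cong : ∀ {A B : Matrix} → (∀ i j → A i j ≡ B i j) → ∑∑ A ≡ ∑∑ B
    ∑∑-cong p = ∑-cong λ i → ∑-cong (p i)

    ∑∑-+ : ∀ (A B : Matrix) → ∑∑ (λ i j → A i j + B i j) ≡ ∑∑ A + ∑∑ B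
    ∑∑-+ A B = trans (∑-cong λ i → ∑-distrib-+ (A i) (B i)) (∑-distrib-+ (∑ ∘ A) (∑ ∘ B))

    ∑∑-*ˡ : ∀ c (A : Matrix) → ∑∑ (λ i j → c * A i j) ≡ c * ∑∑ A
    ∑∑-*ˡ c A = trans (∑-cong λ i → ∑-*ˡ c (A i)) (∑-*ˡ c (∑ ∘ A))

    ∑∑-zero : ∑∑ (λ _ _ → 0ℤ) ≡ 0ℤ
    ∑∑-zero = trans (∑-cong {n} λ _ → zero-sum) zero-sum
      where
      zero-sum : ∑ {n} (λ _ → 0ℤ) ≡ 0ℤ
      zero-sum = trans (∑-const n 0ℤ) (*-zeroʳ (+ n))

    -- The left side is the Frobenius product of two rank-one matrices.
    rank-one-product : ∀ (x y x′ y′ : Vector) →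
      ∑∑ (λ i j → x i * y j * (x′ i * y′ j)) ≡ ⟨ x , x′ ⟩ * ⟨ y , y′ ⟩
    rank-one-product x y x′ y′ =
      trans (∑∑-cong λ i j → regroup (x i) (y j) (x′ i) (y′ j))
            (∑-product (λ i → x i * x′ i) (λ j → y j * y′ j))
      where
      regroup : ∀ a b c d → a * b * (c * d) ≡ a * c * (b * d)
      regroup = solve-∀

    module SignMatrix (E : Matrix) (E² : ∀ i j → E i j * E i j ≡ 1ℤ) (H : ℤ) (H≥0 : 0ℤ ≤ H) where

      image : Vector → Vector
      image q i = ⟨ E i , q ⟩

      energy : Vector → ℤ
      energy q = ⟨ image q , image q ⟩

      totalEnergy : List Vector → ℤ
      totalEnergy []       = 0ℤ
      totalEnergy (q ∷ qs) = energy q + totalEnergy qs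

      -- The matrix `Q = Σ (E q) qᵀ`. Its Frobenius product with `E` is the total energy, while its
      -- norm is small for an almost orthogonal list, so too many vectors of large energy are
      -- incompatible with the norm of `E`.
      combination : List Vector → Matrix
      combination []       i j = 0ℤ
      combination (q ∷ qs) i j = image q i * q j + combination qs i j

      pairing : ∀ qs → ∑∑ (λ i j → E i j * combination qs i j) ≡ totalEnergy qs
      pairing [] = trans (∑∑-cong λ i j → *-zeroʳ (E i j)) (∑∑-zero)
      pairing (q ∷ qs) = begin
        ∑∑ (λ i j → E i j * (image q i * q j + combination qs i j))
          ≡⟨ ∑∑-cong (λ i j → expand (E i j) (image q i) (q j) (combination qs i j)) ⟩
        ∑∑ (λ i j → image q i * (E i j * q j) + E i j * combination qs i j)
          ≡⟨ ∑∑-+ (λ i j → image q i * (E i j * q j)) _ ⟩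
        ∑∑ (λ i j → image q i * (E i j * q j)) + ∑∑ (λ i j → E i j * combination qs i j)
          ≡⟨ cong₂ _+_ (∑-cong λ i → ∑-*ˡ (image q i) (λ j → E i j * q j)) (pairing qs) ⟩
        energy q + totalEnergy qs ∎
        where
        open ≡-Reasoning
        expand : ∀ e p q c → e * (p * q + c) ≡ p * (e * q) + e * c
        expand = solve-∀

      -- The image condition is scaled by the energy of the second vector alone: newer edges stand
      -- in front of older ones, and the test of the older edge is what controls the product. The
      -- tolerance is `1 / H`.
      record AlmostOrthogonal (D : ℤ) (q q′ : Vector) : Set where
        field
          images-lower : - energy q′ ≤ H * ⟨ image q , image q′ ⟩
          images-upper : H * ⟨ image q , image q′ ⟩ ≤ energy q′
          inner-lower  : - D ≤ ⟨ q , q′ ⟩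
          inner-upper  : ⟨ q , q′ ⟩ ≤ D

      module _ (D : ℤ) where
        -- Each `q′` in the list contributes `⟨Eq, Eq′⟩⟨q, q′⟩`, which is at most `energy q′ / H`
        -- times `D`.
        cross-bound : ∀ q qs → All (AlmostOrthogonal D q) qs →
          H * ∑∑ (λ i j → image q i * q j * combination qs i j) ≤ D * totalEnergy qs
        cross-bound q [] [] = ≤-reflexive (trans
          (trans (cong (H *_) (trans (∑∑-cong λ i j → *-zeroʳ (image q i * q j)) ∑∑-zero)) (*-zeroʳ H))
          (sym (*-zeroʳ D)))
        cross-bound q (q′ ∷ qs) (o ∷ os) = begin
          H * ∑∑ (λ i j → image q i * q j * (image q′ i * q′ j + combination qs i j))
            ≡⟨ cong (H *_) (trans
                 (∑∑-cong λ i j → *-distribˡ-+ (image q i * q j) (image q′ i * q′ j) (combination qs i j))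
                 (∑∑-+ (λ i j → image q i * q j * (image q′ i * q′ j)) _)) ⟩
          H * (∑∑ (λ i j → image q i * q j * (image q′ i * q′ j)) + rest)
            ≡⟨ cong (λ c → H * (c + rest)) (rank-one-product (image q) q (image q′) q′) ⟩
          H * (⟨ image q , image q′ ⟩ * ⟨ q , q′ ⟩ + rest)
            ≤⟨ by (gap (product-bound (AlmostOrthogonal.images-lower o) (AlmostOrthogonal.images-upper o)
                                      (AlmostOrthogonal.inner-lower o) (AlmostOrthogonal.inner-upper o))
                   ⊕ gap (cross-bound q qs os))
                  (regroup H ⟨ image q , image q′ ⟩ ⟨ q , q′ ⟩ rest D (energy q′) (totalEnergy qs)) ⟩
          D * totalEnergy (q′ ∷ qs) ∎
          where
          open ≤-Reasoning
          rest : ℤ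
          rest = ∑∑ (λ i j → image q i * q j * combination qs i j)
          regroup : ∀ H a b r D e t →
            (e * D - H * a * b) + (D * t - H * r) ≡ D * (e + t) - H * (a * b + r)
          regroup = solve-∀

        -- The diagonal terms give at most `D` times the total energy. Each pair of distinct entries
        -- occurs twice and costs `D / H` times the energy of its older vector, which over a list of
        -- length l adds at most the factor `2 l / H`.
        square-bound : ∀ qs → AllPairs (AlmostOrthogonal D) qs → All (λ q → ⟨ q , q ⟩ ≤ D) qs → 0ℤ ≤ D →
          H * ∑∑ (λ i j → combination qs i j * combination qs i j) ≤
          D * totalEnergy qs * (H + + 2 * + length qs)
        square-bound [] [] [] _ = ≤-reflexive (trans
          (trans (cong (H *_) ∑∑-zero) (*-zeroʳ H))
          (zero-product H D))
          where
          zero-product : ∀ H D → 0ℤ ≡ D * 0ℤ * (H + 0ℤ)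
          zero-product = solve-∀
        square-bound (q ∷ qs) (o ∷ os) (b ∷ bs) D≥0 = begin
          H * ∑∑ (λ i j → (image q i * q j + Q i j) * (image q i * q j + Q i j))
            ≡⟨ cong (H *_) (∑∑-cong λ i j → binomial (image q i * q j) (Q i j)) ⟩
          H * ∑∑ (λ i j → image q i * q j * (image q i * q j) + (+ 2 * (image q i * q j * Q i j) + Q i j * Q i j))
            ≡⟨ cong (H *_) (trans (∑∑-+ (λ i j → image q i * q j * (image q i * q j)) _)
                 (cong₂ _+_ (rank-one-product (image q) q (image q) q)
                   (trans (∑∑-+ (λ i j → + 2 * (image q i * q j * Q i j)) _)
                     (cong (_+ squares) (∑∑-*ˡ (+ 2) (λ i j → image q i * q j * Q i j)))))) ⟩
          H * (energy q * ⟨ q , q ⟩ + (+ 2 * cross + squares))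
            ≤⟨ by (H≥0 ⊗ (∑-nonneg (λ i → square≥0 (image q i)) ⊗ gap b)
                   ⊕ 2 · gap (cross-bound q qs o)
                   ⊕ gap (square-bound qs os bs D≥0)
                   ⊕ D≥0 ⊗ ∑-nonneg (λ i → square≥0 (image q i)) ⊗ (2 · 0≤+ {suc (length qs)}))
                  (regroup H (energy q) ⟨ q , q ⟩ cross squares D (totalEnergy qs) (+ length qs)) ⟩
          D * totalEnergy (q ∷ qs) * (H + + 2 * + length (q ∷ qs)) ∎
          where
          open ≤-Reasoning
          Q = combination qs
          cross squares : ℤ
          cross   = ∑∑ (λ i j → image q i * q j * Q i j)
          squares = ∑∑ (λ i j → Q i j * Q i j)
          binomial : ∀ a c → (a + c) * (a + c) ≡ a * a + (+ 2 * (a * c) + c * c)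
          binomial = solve-∀
          regroup : ∀ H e b x s D t l →
            H * (e * (D - b)) + + 2 * (D * t - H * x)
              + (D * t * (H + + 2 * l) - H * s)
              + D * e * (+ 2 * (1ℤ + l))
            ≡ D * (e + t) * (H + + 2 * (1ℤ + l)) - H * (e * b + (+ 2 * x + s))
          regroup = solve-∀

      -- Expands `H ‖α E - Q‖² ≥ 0`. All entries of `E` are signs, so `‖E‖² = n²`; the product of
      -- `E` and `Q` is given by `pairing`, and `‖Q‖²` is bounded by `square-bound`.
      energy-bound : ∀ D qs (α : ℤ) → AllPairs (AlmostOrthogonal D) qs → All (λ q → ⟨ q , q ⟩ ≤ D) qs → 0ℤ ≤ D →
        + 2 * H * α * totalEnergy qs ≤
        H * (α * α * (+ n * + n)) + D * totalEnergy qs * (H + + 2 * + length qs)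
      energy-bound D qs α os bs D≥0 = by
        (H≥0 ⊗ subst (_≤_ 0ℤ) expanded (∑-nonneg λ i → ∑-nonneg λ j → square≥0 (α * E i j - Q i j))
         ⊕ gap (square-bound D qs os bs D≥0))
        (regroup H α (+ n * + n) (totalEnergy qs) squares (D * totalEnergy qs * (H + + 2 * + length qs)))
        where
        Q = combination qs
        squares = ∑∑ (λ i j → Q i j * Q i j)
        expand : ∀ a e c → (a * e - c) * (a * e - c) ≡ a * a * (e * e) + (- (+ 2 * a) * (e * c) + c * c)
        expand = solve-∀
        regroup : ∀ H a N t s r →
          H * (a * a * N + (- (+ 2 * a) * t + s)) + (r - H * s) ≡ H * (a * a * N) + r - + 2 * H * a * t
        regroup = solve-∀
        ones : ∑∑ (λ i j → E i j * E i j) ≡ + n * + n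
        ones = trans (∑∑-cong E²) (trans (∑-cong {n} λ _ → ∑-const n 1ℤ)
                 (trans (∑-const n (+ n * 1ℤ)) (cong (+ n *_) (*-identityʳ (+ n)))))
        expanded : ∑∑ (λ i j → (α * E i j - Q i j) * (α * E i j - Q i j)) ≡
                   α * α * (+ n * + n) + (- (+ 2 * α) * totalEnergy qs + squares)
        expanded = begin
          ∑∑ (λ i j → (α * E i j - Q i j) * (α * E i j - Q i j))
            ≡⟨ ∑∑-cong (λ i j → expand α (E i j) (Q i j)) ⟩
          ∑∑ (λ i j → α * α * (E i j * E i j) + (- (+ 2 * α) * (E i j * Q i j) + Q i j * Q i j))
            ≡⟨ trans (∑∑-+ (λ i j → α * α * (E i j * E i j)) _)
                 (cong₂ _+_ (trans (∑∑-*ˡ (α * α) (λ i j → E i j * E i j)) (cong (α * α *_) ones))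
                   (trans (∑∑-+ (λ i j → - (+ 2 * α) * (E i j * Q i j)) _)
                     (cong (_+ squares) (trans (∑∑-*ˡ (- (+ 2 * α)) (λ i j → E i j * Q i j))
                        (cong (- (+ 2 * α) *_) (pairing qs)))))) ⟩
          α * α * (+ n * + n) + (- (+ 2 * α) * totalEnergy qs + squares) ∎
          where open ≡-Reasoning

  -- Triangle-free graphs of bounded degree

  Bucket : ℕ → ℤ → ℤ → Set
  Bucket K M ψ = Σ[ r ∈ Fin K ] + toℕ r * M ≤ ψ × ψ < (1ℤ + + toℕ r) * M

  bucket : ∀ K {M ψ} → 0ℤ ≤ ψ → ψ < + K * M → Bucket K M ψ
  bucket zero {M} 0≤ψ ψ<0 = ⊥-elim (<⇒≱ ψ<0 (≤-trans (≤-reflexive (*-zeroˡ M)) 0≤ψ))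
  bucket (suc K) {M} {ψ} 0≤ψ ψ<KM with ψ <? + K * M
  ... | yes ψ< with r , lo , hi ← bucket K 0≤ψ ψ< =
        inject₁ r , subst (λ k → + k * M ≤ ψ) (sym (Fin.toℕ-inject₁ r)) lo ,
                    subst (λ k → ψ < (1ℤ + + k) * M) (sym (Fin.toℕ-inject₁ r)) hi
  ... | no  ψ≮ = Fin.fromℕ K , subst (λ k → + k * M ≤ ψ) (sym (Fin.toℕ-fromℕ K)) (≮⇒≥ ψ≮) ,
                           subst (λ k → ψ < (1ℤ + + k) * M) (sym (Fin.toℕ-fromℕ K)) ψ<KM

  same-bucket-close : ∀ {K M ψ ω} (i : Bucket K M ψ) (j : Bucket K M ω) → proj₁ i ≡ proj₁ j → ψ - ω ≤ M
  same-bucket-close {K} {M} {ψ} {ω} (r , _ , hi) (.r , lo , _) refl = by (gap lo ⊕ gap (<⇒≤ hi)) (certificate M ψ ω (+ toℕ r))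
    where
    certificate : ∀ M ψ ω r → (ω - r * M) + ((1ℤ + r) * M - ψ) ≡ M - (ψ - ω)
    certificate = solve-∀

  infixl 7 _⊗⁺_

  _⊗⁺_ : ∀ {a b} → 0ℤ < a → 0ℤ < b → 0ℤ < a * b
  _⊗⁺_ {+[1+ a ]} {+[1+ b ]} _ _ = +<+ z<s
  _⊗⁺_ {+ 0} (+<+ ()) _
  _⊗⁺_ {+[1+ a ]} {+ 0} _ (+<+ ())

  -- Here `e` is the total energy of `k` vectors, and the last hypothesis is `energy-bound` with
  -- `α = D = 2d`, that is `e (H - 2k) ≤ 2 d n² H`. The left side is at least `(39/2) d³ (H - 2k)`
  -- and the right side at most `(452/25) d³ H`; multiplied by 50 the coefficients are 975 and 904.
  energy-contradiction : ∀ {H d n e k} → 0ℤ < H → 0ℤ < d → + 2 * k ≤ H →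
    + 904 * H < + 975 * (H - + 2 * k) →
    + 25 * (n * n) ≤ + 226 * (d * d) → + 39 * (d * d * d) ≤ + 2 * e →
    + 2 * H * (+ 2 * d) * e ≤ H * (+ 2 * d * (+ 2 * d) * (n * n)) + + 2 * d * e * (H + + 2 * k) → ⊥
  energy-contradiction {H} {d} {n} {e} {k} H>0 d>0 H≥2k H≫k n≤ e≥ bound = <⇒≱ positive-part (by
      (25 · gap bound ⊕ 4 · (<⇒≤ H>0 ⊗ (<⇒≤ d>0 ⊗ <⇒≤ d>0 ⊗ gap n≤)) ⊕ 25 · (gap H≥2k ⊗ (<⇒≤ d>0 ⊗ gap e≥)))
      (certificate H d n e k))
    where
    0<gap : ∀ {i j} → i < j → 0ℤ < j - i
    0<gap {i} {j} i<j = subst (_< j - i) (+-inverseʳ i) (+-monoˡ-< (- i) i<j)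
    positive-part : 0ℤ < (+ 975 * (H - + 2 * k) - + 904 * H) * (d * d * (d * d))
    positive-part = 0<gap H≫k ⊗⁺ (d>0 ⊗⁺ d>0 ⊗⁺ (d>0 ⊗⁺ d>0))
    certificate : ∀ H d n e k →
      + 25 * (H * (+ 2 * d * (+ 2 * d) * (n * n)) + + 2 * d * e * (H + + 2 * k) - + 2 * H * (+ 2 * d) * e)
      + + 4 * (H * (d * d * (+ 226 * (d * d) - + 25 * (n * n))))
      + + 25 * ((H - + 2 * k) * (d * (+ 2 * e - + 39 * (d * d * d))))
      ≡ 0ℤ - (+ 975 * (H - + 2 * k) - + 904 * H) * (d * d * (d * d))
    certificate = solve-∀

  module TriangleFree {n : ℕ} (adj : Fin n → Fin n → Bool)
    (adj-sym : ∀ {u v} → adj u v ≡ true → adj v u ≡ true)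
    (triangle-free : ∀ {u v w} → adj u v ≡ true → adj v w ≡ true → adj u w ≡ true → ⊥)
    where

    deg : Fin n → ℤ
    deg v = size (adj v)

    -- Colours are assigned to all vertices but constrained only inside `S`, so that colourings of
    -- parts can be glued.
    Colouring : ℕ → (Fin n → Bool) → Set
    Colouring k S = Σ[ c ∈ (Fin n → Fin k) ]
      (∀ {u v} → S u ≡ true → S v ≡ true → adj u v ≡ true → c u ≢ c v)

    -- Colouring by the tests of a growing list of edges

    module Separation (B k : ℕ) .{{_ : NonZero B}}
      (test : ∀ u v → adj u v ≡ true → Fin n → Fin B)
      where

      Edge : Set
      Edge = Σ[ u ∈ Fin n ] Σ[ v ∈ Fin n ] adj u v ≡ true

      testBy : Edge → Fin n → Fin B
      testBy (u , v , uv) = test u v uv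

      Unseparated : Edge → Edge → Set
      Unseparated (u , v , _) e = testBy e u ≡ testBy e v

      colour : (es : List Edge) → Fin n → Fin (B ℕ.^ length es)
      colour []       x = zero
      colour (e ∷ es) x = combine (testBy e x) (colour es x)

      colour-injective : ∀ es {u v} → colour es u ≡ colour es v → All (λ e → testBy e u ≡ testBy e v) es
      colour-injective []       _  = []
      colour-injective (e ∷ es) eq with p , q ← combine-injective _ _ _ _ eq = p ∷ colour-injective es q

      -- Vertices are coloured by their answers to the tests of the listed edges. An edge inside a
      -- colour class is put in front of the list; its ends agree in all earlier tests, so the list
      -- stays pairwise `Unseparated` and cannot exceed length k. In `search`, `j` counts the
      -- extensions still allowed.
      separate : (∀ es → AllPairs Unseparated es → length es ≢ suc k) → Colouring (B ℕ.^ k) (λ _ → true)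
      separate bounded = search k [] [] refl
        where
        search : ∀ j es → AllPairs Unseparated es → length es ℕ.+ j ≡ k → Colouring (B ℕ.^ k) (λ _ → true)
        search j es pairs eq
          with any? (λ u → any? λ v → (adj u v Bool.≟ true) ×-dec (colour es u Fin.≟ colour es v))
        ... | no  none = (λ x → inject≤ (colour es x) len) ,
                         λ {u} {v} _ _ uv same → none (u , v , uv , inject≤-injective len len _ _ same)
          where
          len : B ℕ.^ length es ℕ.≤ B ℕ.^ k
          len = ℕ.^-monoʳ-≤ B (subst (length es ℕ.≤_) eq (ℕ.m≤m+n (length es) j))
        search zero es pairs eq | yes (u , v , uv , same) =
          ⊥-elim (bounded ((u , v , uv) ∷ es) (colour-injective es same ∷ pairs)
                   (cong suc (trans (sym (ℕ.+-identityʳ _)) eq)))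
        search (suc j) es pairs eq | yes (u , v , uv , same) =
          search j ((u , v , uv) ∷ es) (colour-injective es same ∷ pairs) (trans (sym (ℕ.+-suc _ j)) eq)

    -- The parameter `K` replaces asymptotic statements: n is at most `(3 + 1/K) d` and f at most
    -- `d / K`. The tolerance for almost orthogonality is `1 / H`.
    module BoundedDegree (d f : ℕ) (d>0 : 0ℤ < + d)
      (min-degree : ∀ v → + d ≤ deg v)
      (max-degree : ∀ v → + 9 * deg v ≤ + 5 * + n + + 30 * + f)
      (K : ℤ) (K≥952 : + 952 ≤ K) (n≤3d : K * + n ≤ (+ 3 * K + 1ℤ) * + d) (f≪d : K * + f ≤ + d)
      (H : ℤ) (H>0 : 0ℤ < H)
      where

      opaque
        -- Exactly d neighbours are kept at every vertex, so that the entries of every `q u v` sum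
        -- to zero and its squared norm is at most 2d.
        nbrs : Fin n → Fin n → Bool
        nbrs v = proj₁ (subsetOfSize (adj v) d (min-degree v))

        nbrs⊆adj : ∀ v i → nbrs v i ≡ true → adj v i ≡ true
        nbrs⊆adj v = proj₁ (proj₂ (subsetOfSize (adj v) d (min-degree v)))

        size-nbrs : ∀ v → size (nbrs v) ≡ + d
        size-nbrs v = proj₂ (proj₂ (subsetOfSize (adj v) d (min-degree v)))

      g : Fin n → Vector
      g v i = ⟦ nbrs v i ⟧

      sign : Bool → ℤ
      sign true  = 1ℤ
      sign false = - 1ℤ

      sign² : ∀ b → sign b * sign b ≡ 1ℤ
      sign² true  = refl
      sign² false = refl

      open SignMatrix (λ i j → sign (adj i j)) (λ i j → sign² (adj i j)) H (<⇒≤ H>0)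

      K>0 : 0ℤ < K
      K>0 = <-≤-trans (+<+ z<s) K≥952

      K≥0 : 0ℤ ≤ K
      K≥0 = <⇒≤ K>0

      q : Fin n → Fin n → Vector
      q u v i = g u i - g v i

      -- Pointwise, the first factor is at most `g u + g v` in absolute value and the second at most
      -- 1.
      q-inner-upper : ∀ u v u′ v′ → ⟨ q u v , q u′ v′ ⟩ ≤ + 2 * + d
      q-inner-upper u v u′ v′ = begin
        ⟨ q u v , q u′ v′ ⟩ ≤⟨ ∑-mono (λ i → pointwise (nbrs u i) (nbrs v i) (nbrs u′ i) (nbrs v′ i)) ⟩
        ∑ (λ i → g u i + g v i) ≡⟨ ∑-distrib-+ (g u) (g v) ⟩
        ∑ (g u) + ∑ (g v) ≡⟨ cong₂ _+_ (size-nbrs u) (size-nbrs v) ⟩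
        + d + + d ≡⟨ double (+ d) ⟩
        + 2 * + d ∎
        where
        open ≤-Reasoning
        double : ∀ a → a + a ≡ + 2 * a
        double = solve-∀
        pointwise : ∀ a b c e → (⟦ a ⟧ - ⟦ b ⟧) * (⟦ c ⟧ - ⟦ e ⟧) ≤ ⟦ a ⟧ + ⟦ b ⟧
        pointwise a b c e = ≤-trans
          (product-bound {⟦ a ⟧ - ⟦ b ⟧} {⟦ c ⟧ - ⟦ e ⟧} {⟦ a ⟧ + ⟦ b ⟧} {1ℤ}
            (by (2 · ⟦⟧≥0 a) (lower ⟦ a ⟧ ⟦ b ⟧)) (by (2 · ⟦⟧≥0 b) (upper ⟦ a ⟧ ⟦ b ⟧))
            (by (⟦⟧≥0 c ⊕ gap (⟦⟧≤1 e)) (lower′ ⟦ c ⟧ ⟦ e ⟧)) (by (gap (⟦⟧≤1 c) ⊕ ⟦⟧≥0 e) (upper′ ⟦ c ⟧ ⟦ e ⟧)))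
          (≤-reflexive (*-identityʳ _))
          where
          lower : ∀ x y → + 2 * x ≡ x - y - - (x + y)
          lower = solve-∀
          upper : ∀ x y → + 2 * y ≡ x + y - (x - y)
          upper = solve-∀
          lower′ : ∀ x y → x + (1ℤ - y) ≡ x - y - - 1ℤ
          lower′ = solve-∀
          upper′ : ∀ x y → 1ℤ - x + y ≡ 1ℤ - (x - y)
          upper′ = solve-∀

      q-inner-lower : ∀ u v u′ v′ → - (+ 2 * + d) ≤ ⟨ q u v , q u′ v′ ⟩
      q-inner-lower u v u′ v′ = begin
        - (+ 2 * + d)          ≤⟨ neg-mono-≤ (q-inner-upper v u u′ v′) ⟩
        - ⟨ q v u , q u′ v′ ⟩  ≡⟨ ∑-neg _ ⟨
        ∑ (λ i → - (q v u i * q u′ v′ i)) ≡⟨ ∑-cong (λ i → flip (g u i) (g v i) (q u′ v′ i)) ⟩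
        ⟨ q u v , q u′ v′ ⟩ ∎
        where
        open ≤-Reasoning
        flip : ∀ a b c → - ((b - a) * c) ≡ (a - b) * c
        flip = solve-∀

      -- For an edge `uv` the sets `nbrs u` and `nbrs v` are disjoint, so this is the degree of `w`
      -- into their union.
      crossing : Fin n → Fin n → Fin n → ℤ
      crossing u v w = ∑ λ b → ⟦ adj w b ⟧ * (g u b + g v b)

      no-common-neighbour : ∀ {u v w} → adj u v ≡ true → adj u w ≡ true → adj v w ≡ true → ⊥
      no-common-neighbour uv uw vw = triangle-free uw (adj-sym vw) uv

      -- A sign is `2 adj - 1`. By triangle-freeness `w` has no neighbour in `nbrs u`, so
      -- `adj (g u - g v)` equals `- adj (g u + g v)`. The remaining part `g v - g u` sums to zero
      -- because both sets have size d.
      image-crossing : ∀ u v → adj u v ≡ true → ∀ w → nbrs u w ≡ true →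
        image (q u v) w ≡ - (+ 2) * crossing u v w
      image-crossing u v uv w w∈u = begin
        image (q u v) w
          ≡⟨ ∑-cong pointwise ⟩
        ∑ (λ b → - (+ 2) * (⟦ adj w b ⟧ * (g u b + g v b)) + (g v b - g u b))
          ≡⟨ ∑-distrib-+ _ _ ⟩
        ∑ (λ b → - (+ 2) * (⟦ adj w b ⟧ * (g u b + g v b))) + ∑ (λ b → g v b - g u b)
          ≡⟨ cong₂ _+_ (∑-*ˡ (- (+ 2)) _)
               (trans (∑-distrib-- (g v) (g u)) (trans (cong₂ _-_ (size-nbrs v) (size-nbrs u)) (+-inverseʳ (+ d)))) ⟩
        - (+ 2) * crossing u v w + 0ℤ
          ≡⟨ +-identityʳ _ ⟩
        - (+ 2) * crossing u v w ∎
        where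
        open ≡-Reasoning
        pointwise : ∀ b → sign (adj w b) * (g u b - g v b) ≡
                    - (+ 2) * (⟦ adj w b ⟧ * (g u b + g v b)) + (g v b - g u b)
        pointwise b with nbrs u b in b∈u | nbrs v b in b∈v | adj w b in wb
        ... | true  | true  | _     = ⊥-elim (no-common-neighbour uv (nbrs⊆adj u b b∈u) (nbrs⊆adj v b b∈v))
        ... | true  | false | true  =
          ⊥-elim (triangle-free (nbrs⊆adj u w w∈u) wb (nbrs⊆adj u b b∈u))
        ... | true  | false | false = refl
        ... | false | true  | true  = refl
        ... | false | true  | false = refl
        ... | false | false | true  = refl
        ... | false | false | false = refl

      crossing-comm : ∀ u v w → crossing u v w ≡ crossing v u w
      crossing-comm u v w = ∑-cong λ b → cong (⟦ adj w b ⟧ *_) (+-comm (g u b) (g v b))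

      image-swap : ∀ u v w → image (q u v) w ≡ - image (q v u) w
      image-swap u v w = trans (∑-cong λ b → swap (sign (adj w b)) (g u b) (g v b))
        (∑-neg (λ b → sign (adj w b) * q v u b))
        where
        swap : ∀ e a b → e * (a - b) ≡ - (e * (b - a))
        swap = solve-∀

      τ : Fin n → Fin n → Vector
      τ u v w = g u w + g v w

      ∑τ : ∀ u v → ∑ (τ u v) ≡ + 2 * + d
      ∑τ u v = trans (∑-distrib-+ (g u) (g v)) (trans (cong₂ _+_ (size-nbrs u) (size-nbrs v)) (double (+ d)))
        where
        double : ∀ a → a + a ≡ + 2 * a
        double = solve-∀

      -- 36 D² ≥ 12 d D - d², which is sharp when the crossing degree D is d/6.
      energy-pointwise : ∀ u v → adj u v ≡ true → ∀ w →
        τ u v w * (+ 12 * + d * crossing u v w - + d * + d) ≤ + 9 * (image (q u v) w * image (q u v) w)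
      energy-pointwise u v uv w with nbrs u w in w∈u | nbrs v w in w∈v
      ... | true | true = ⊥-elim (no-common-neighbour uv (nbrs⊆adj u w w∈u) (nbrs⊆adj v w w∈v))
      ... | false | false = ≤-trans (≤-reflexive (*-zeroˡ (+ 12 * + d * crossing u v w - + d * + d))) (by (9 · square≥0 (image (q u v) w)) (sym (m-0 (+ 9 * (image (q u v) w * image (q u v) w)))))
        where
        m-0 : ∀ a → a - 0ℤ ≡ a
        m-0 = solve-∀
      ... | true | false = subst (λ p → (1ℤ + 0ℤ) * (+ 12 * + d * crossing u v w - + d * + d) ≤ + 9 * (p * p))
        (sym (image-crossing u v uv w w∈u))
        (by (square≥0 (+ 6 * crossing u v w - + d)) (complete (crossing u v w) (+ d)))
        where
        complete : ∀ D d → (+ 6 * D - d) * (+ 6 * D - d) ≡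
          + 9 * (- (+ 2) * D * (- (+ 2) * D)) - (1ℤ + 0ℤ) * (+ 12 * d * D - d * d)
        complete = solve-∀
      ... | false | true = subst (λ p → (0ℤ + 1ℤ) * (+ 12 * + d * crossing u v w - + d * + d) ≤ + 9 * (p * p))
        (sym (trans (image-swap u v w) (cong -_ (trans (image-crossing v u (adj-sym uv) w w∈v)
          (cong (- (+ 2) *_) (crossing-comm v u w))))))
        (by (square≥0 (+ 6 * crossing u v w - + d)) (complete (crossing u v w) (+ d)))
        where
        complete : ∀ D d → (+ 6 * D - d) * (+ 6 * D - d) ≡
          + 9 * (- (- (+ 2) * D) * - (- (+ 2) * D)) - (0ℤ + 1ℤ) * (+ 12 * d * D - d * d)
        complete = solve-∀

      -- Few edges leave the two d-subsets because all degrees outside are at most about 5n/9.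
      crossing-total : ∀ u v → adj u v ≡ true →
        + 18 * (+ d * + d) - (+ n - + 2 * + d) * (+ 5 * + n + + 30 * + f) ≤
        + 9 * ∑ (λ w → τ u v w * crossing u v w)
      crossing-total u v uv = by
        (9 · gap inside+outside ⊕ gap outside)
        (arrange inner outer (+ d))
        where
        Δ = + 5 * + n + + 30 * + f
        inner outer : ℤ
        inner = ∑ (λ w → τ u v w * crossing u v w)
        outer = ∑ (λ b → (1ℤ - τ u v b) * ∑ (λ w → ⟦ adj w b ⟧ * τ u v w))
        arrange : ∀ i o d → + 9 * (i + o - + 2 * d * d) + ((+ n - + 2 * d) * Δ - + 9 * o) ≡
          + 9 * i - (+ 18 * (d * d) - (+ n - + 2 * d) * Δ)
        arrange i o d = arrange′ i o d ((+ n - + 2 * d) * Δ)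
          where
          arrange′ : ∀ i o d z → + 9 * (i + o - + 2 * d * d) + (z - + 9 * o) ≡ + 9 * i - (+ 18 * (d * d) - z)
          arrange′ = solve-∀
        τ≥0 : ∀ w → 0ℤ ≤ τ u v w
        τ≥0 w = ⟦⟧≥0 (nbrs u w) ⊕ ⟦⟧≥0 (nbrs v w)
        1-τ≥0 : ∀ w → 0ℤ ≤ 1ℤ - τ u v w
        1-τ≥0 w with nbrs u w in w∈u | nbrs v w in w∈v
        ... | true  | true  = ⊥-elim (no-common-neighbour uv (nbrs⊆adj u w w∈u) (nbrs⊆adj v w w∈v))
        ... | true  | false = ≤-refl
        ... | false | true  = ≤-refl
        ... | false | false = +≤+ z≤n
        inside+outside : + 2 * + d * + d ≤ inner + outer
        inside+outside = begin
          + 2 * + d * + d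
            ≡⟨ cong (_* + d) (∑τ u v) ⟨
          ∑ (τ u v) * + d
            ≡⟨ ∑-*ʳ (+ d) (τ u v) ⟨
          ∑ (λ w → τ u v w * + d)
            ≤⟨ ∑-mono (λ w → by (τ≥0 w ⊗ gap (min-degree w)) (distrib (τ u v w) (deg w) (+ d))) ⟩
          ∑ (λ w → τ u v w * deg w)
            ≡⟨ ∑-cong (λ w → trans (cong (τ u v w *_) (split w)) (*-distribˡ-+ (τ u v w) (crossing u v w) _)) ⟩
          ∑ (λ w → τ u v w * crossing u v w + τ u v w * ∑ (λ b → ⟦ adj w b ⟧ * (1ℤ - τ u v b)))
            ≡⟨ ∑-distrib-+ _ _ ⟩
          inner + ∑ (λ w → τ u v w * ∑ (λ b → ⟦ adj w b ⟧ * (1ℤ - τ u v b)))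
            -- Edges leaving the union are counted again from their outer ends.
            ≡⟨ cong (_+_ inner) (trans (∑-cong λ w → sym (∑-*ˡ (τ u v w) _)) (trans (∑-comm _)
                 (∑-cong λ b → trans (∑-cong λ w → rotate (τ u v w) ⟦ adj w b ⟧ (1ℤ - τ u v b))
                                     (∑-*ˡ (1ℤ - τ u v b) _)))) ⟩
          inner + outer ∎
          where
          open ≤-Reasoning
          distrib : ∀ t e d → t * (e - d) ≡ t * e - t * d
          distrib = solve-∀
          rotate : ∀ a b c → a * (b * c) ≡ c * (b * a)
          rotate = solve-∀
          split : ∀ w → deg w ≡ crossing u v w + ∑ (λ b → ⟦ adj w b ⟧ * (1ℤ - τ u v b))
          split w = trans (∑-cong λ b → splitAt ⟦ adj w b ⟧ (τ u v b)) (∑-distrib-+ _ _)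
            where
            splitAt : ∀ a t → a ≡ a * t + a * (1ℤ - t)
            splitAt = solve-∀
        outside : + 9 * outer ≤ (+ n - + 2 * + d) * Δ
        outside = begin
          + 9 * outer
            ≡⟨ ∑-*ˡ (+ 9) _ ⟨
          ∑ (λ b → + 9 * ((1ℤ - τ u v b) * ∑ (λ w → ⟦ adj w b ⟧ * τ u v w)))
            ≤⟨ ∑-mono bound ⟩
          ∑ (λ b → (1ℤ - τ u v b) * Δ)
            ≡⟨ ∑-*ʳ Δ _ ⟩
          ∑ (λ b → 1ℤ - τ u v b) * Δ
            ≡⟨ cong (_* Δ) (trans (∑-distrib-- (λ _ → 1ℤ) (τ u v))
                 (cong₂ _-_ (trans (∑-const n 1ℤ) (*-identityʳ (+ n))) (∑τ u v))) ⟩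
          (+ n - + 2 * + d) * Δ ∎
          where
          open ≤-Reasoning
          adj≤ : ∀ b w → ⟦ adj w b ⟧ * τ u v w ≤ ⟦ adj b w ⟧
          adj≤ b w with adj w b in wb
          ... | false = ≤-trans (≤-reflexive (*-zeroˡ (τ u v w))) (⟦⟧≥0 (adj b w))
          ... | true rewrite adj-sym wb = by (1-τ≥0 w) (cong (_-_ 1ℤ) (sym (*-identityˡ (τ u v w))))
          bound : ∀ b → + 9 * ((1ℤ - τ u v b) * ∑ (λ w → ⟦ adj w b ⟧ * τ u v w)) ≤ (1ℤ - τ u v b) * Δ
          bound b = by (1-τ≥0 b ⊗ gap (≤-trans (*-monoˡ-≤-nonNeg (+ 9) (∑-mono (adj≤ b))) (max-degree b)))
            (factor (1ℤ - τ u v b) Δ (∑ (λ w → ⟦ adj w b ⟧ * τ u v w)))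
            where
            factor : ∀ t e s → t * (e - + 9 * s) ≡ t * e - + 9 * (t * s)
            factor = solve-∀

      -- Summing `energy-pointwise` and inserting `crossing-total` gives energy at least
      -- `(2/9 - 68/(9K)) d³`. As `2/9 - 3/14 = 1/126`, this reaches `(3/14) d³` exactly when K is
      -- at least 952.
      energy-lower : ∀ u v → adj u v ≡ true → + 3 * (+ d * + d * + d) ≤ + 14 * energy (q u v)
      energy-lower u v uv = cancel (by
        (14 · (K≥0 ⊗ (9 · gap step))
          ⊕ 14 · (12 · (K≥0 ⊗ (0≤+ {d} ⊗ gap (crossing-total u v uv))))
          ⊕ 168 · (0≤+ {d} ⊗ gap outside≤)
          ⊕ 9 · (gap K≥952 ⊗ (0≤+ {d} ⊗ 0≤+ {d} ⊗ 0≤+ {d})))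
        (certificate K (+ d) ((+ n - + 2 * + d) * (+ 5 * + n + + 30 * + f)) (energy (q u v)) inner))
        where
        inner : ℤ
        inner = ∑ (λ w → τ u v w * crossing u v w)
        cancel : ∀ {a b} → K * (+ 81 * a) ≤ K * (+ 81 * b) → a ≤ b
        cancel p = *-cancelˡ-≤-pos _ _ (+ 81) (*-cancelˡ-≤-pos _ _ K {{positive K>0}} p)
        -- The factors are at most `(1 + 1/K) d` and `(15 + 35/K) d`. Beyond 15 their product has
        -- the terms `50/K + 35/K²`, together at most `51/K`.
        outside≤ : K * ((+ n - + 2 * + d) * (+ 5 * + n + + 30 * + f)) ≤ (+ 15 * K + + 51) * (+ d * + d)
        outside≤ = *-cancelˡ-≤-pos _ _ K {{positive K>0}} (by
          (gap n-2d≤ ⊗ (K≥0 ⊗ (5 · 0≤+ {n} ⊕ 30 · 0≤+ {f}))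
            ⊕ (K≥0 ⊕ 0≤+ {1}) ⊗ (0≤+ {d} ⊗ gap Δ≤)
            ⊕ (gap K≥952 ⊕ 0≤+ {917}) ⊗ (0≤+ {d} ⊗ 0≤+ {d}))
          (multiply K (+ d) (+ n - + 2 * + d) (+ 5 * + n + + 30 * + f)))
          where
          n-2d≤ : K * (+ n - + 2 * + d) ≤ (K + 1ℤ) * + d
          n-2d≤ = by (gap n≤3d) (rearrange K (+ n) (+ d))
            where
            rearrange : ∀ K n d → (+ 3 * K + 1ℤ) * d - K * n ≡ (K + 1ℤ) * d - K * (n - + 2 * d)
            rearrange = solve-∀
          Δ≤ : K * (+ 5 * + n + + 30 * + f) ≤ (+ 15 * K + + 35) * + d
          Δ≤ = by (5 · gap n≤3d ⊕ 30 · gap f≪d) (rearrange K (+ n) (+ d) (+ f))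
            where
            rearrange : ∀ K n d f → + 5 * ((+ 3 * K + 1ℤ) * d - K * n) + + 30 * (d - K * f) ≡
              (+ 15 * K + + 35) * d - K * (+ 5 * n + + 30 * f)
            rearrange = solve-∀
          multiply : ∀ K d a b → ((K + 1ℤ) * d - K * a) * (K * b) + (K + 1ℤ) * (d * ((+ 15 * K + + 35) * d - K * b))
            + (K - + 952 + + 917) * (d * d) ≡ K * ((+ 15 * K + + 51) * (d * d)) - K * (K * (a * b))
          multiply = solve-∀
        step : + 12 * + d * inner - + d * + d * (+ 2 * + d) ≤ + 9 * energy (q u v)
        step = begin
          + 12 * + d * inner - + d * + d * (+ 2 * + d)
            ≡⟨ cong₂ _-_ (sym (∑-*ˡ (+ 12 * + d) _)) (trans (cong (+ d * + d *_) (sym (∑τ u v))) (sym (∑-*ˡ (+ d * + d) (τ u v)))) ⟩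
          ∑ (λ w → + 12 * + d * (τ u v w * crossing u v w)) - ∑ (λ w → + d * + d * τ u v w)
            ≡⟨ ∑-distrib-- _ _ ⟨
          ∑ (λ w → + 12 * + d * (τ u v w * crossing u v w) - + d * + d * τ u v w)
            ≤⟨ ∑-mono (λ w → ≤-trans (≤-reflexive (factor (+ d) (τ u v w) (crossing u v w))) (energy-pointwise u v uv w)) ⟩
          ∑ (λ w → + 9 * (image (q u v) w * image (q u v) w))
            ≡⟨ ∑-*ˡ (+ 9) _ ⟩
          + 9 * energy (q u v) ∎
          where
          open ≤-Reasoning
          factor : ∀ d t c → + 12 * d * (t * c) - d * d * t ≡ t * (+ 12 * d * c - d * d)
          factor = solve-∀
        certificate : ∀ K d w e i →
          + 14 * (K * (+ 9 * (+ 9 * e - (+ 12 * d * i - d * d * (+ 2 * d)))))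
          + + 14 * (+ 12 * (K * (d * (+ 9 * i - (+ 18 * (d * d) - w)))))
          + + 168 * (d * ((+ 15 * K + + 51) * (d * d) - K * w))
          + + 9 * ((K - + 952) * (d * d * d))
          ≡ K * (+ 81 * (+ 14 * e)) - K * (+ 81 * (+ 3 * (d * d * d)))
        certificate = solve-∀

      -- The test of the edge `uv`. It is linear in `g x`, so its values at the two ends of another
      -- edge differ by the inner product of the two images, and close values mean almost orthogonal
      -- images.
      φ : Fin n → Fin n → Fin n → ℤ
      φ u v x = ⟨ image (q u v) , image (g x) ⟩

      φ-difference : ∀ u v u′ v′ → ⟨ image (q u′ v′) , image (q u v) ⟩ ≡ φ u v u′ - φ u v v′
      φ-difference u v u′ v′ = begin
        ⟨ image (q u′ v′) , image (q u v) ⟩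
          ≡⟨ ⟨⟩-comm (image (q u′ v′)) (image (q u v)) ⟩
        ⟨ image (q u v) , image (q u′ v′) ⟩
          ≡⟨ ∑-cong (λ w → cong (image (q u v) w *_) (⟨⟩-distribˡ-- (λ b → sign (adj w b)) (g u′) (g v′))) ⟩
        ⟨ image (q u v) , (λ w → image (g u′) w - image (g v′) w) ⟩
          ≡⟨ ⟨⟩-distribˡ-- (image (q u v)) (image (g u′)) (image (g v′)) ⟩
        φ u v u′ - φ u v v′ ∎
        where open ≡-Reasoning

      image-g-upper : ∀ x w → image (g x) w ≤ + d
      image-g-upper x w = ≤-trans (∑-mono λ b → pointwise (adj w b) (nbrs x b)) (≤-reflexive (size-nbrs x))
        where
        pointwise : ∀ a c → sign a * ⟦ c ⟧ ≤ ⟦ c ⟧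
        pointwise true  c = ≤-reflexive (*-identityˡ ⟦ c ⟧)
        pointwise false true  = -≤+
        pointwise false false = ≤-refl

      image-g-lower : ∀ x w → - + d ≤ image (g x) w
      image-g-lower x w = ≤-trans (≤-reflexive (trans (cong -_ (sym (size-nbrs x))) (sym (∑-neg (g x)))))
        (∑-mono λ b → pointwise (adj w b) (nbrs x b))
        where
        pointwise : ∀ a c → - ⟦ c ⟧ ≤ sign a * ⟦ c ⟧
        pointwise false c = ≤-reflexive (sym (-1*i≡-i ⟦ c ⟧))
        pointwise true  true  = -≤+
        pointwise true  false = ≤-refl

      image-g-norm : ∀ x → ⟨ image (g x) , image (g x) ⟩ ≤ + n * (+ d * + d)
      image-g-norm x = ≤-trans
        (∑-mono λ w → product-bound (image-g-lower x w) (image-g-upper x w) (image-g-lower x w) (image-g-upper x w))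
        (≤-reflexive (∑-const n (+ d * + d)))

      -- Expands `|4x + a y|² ≥ 0`. Taking `a` to be 1 and -1 bounds the test values by `4 M` on
      -- both sides, once the image of `g x` has squared norm below `16 M`.
      square-sum : ∀ (a : ℤ) (x y : Vector {n}) →
        0ℤ ≤ + 16 * ⟨ x , x ⟩ + (+ 8 * a * ⟨ x , y ⟩ + a * a * ⟨ y , y ⟩)
      square-sum a x y = subst (_≤_ 0ℤ) expanded (∑-nonneg λ i → square≥0 (+ 4 * x i + a * y i))
        where
        expand : ∀ a x y → (+ 4 * x + a * y) * (+ 4 * x + a * y) ≡ + 16 * (x * x) + (+ 8 * a * (x * y) + a * a * (y * y))
        expand = solve-∀
        expanded : ∑ (λ i → (+ 4 * x i + a * y i) * (+ 4 * x i + a * y i)) ≡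
          + 16 * ⟨ x , x ⟩ + (+ 8 * a * ⟨ x , y ⟩ + a * a * ⟨ y , y ⟩)
        expanded = trans (∑-cong λ i → expand a (x i) (y i))
          (trans (∑-distrib-+ _ _) (cong₂ _+_ (∑-*ˡ (+ 16) _)
            (trans (∑-distrib-+ _ _) (cong₂ _+_ (∑-*ˡ (+ 8 * a) _) (∑-*ˡ (a * a) _)))))

      -- Quantised tests

      module _ (u v : Fin n) (uv : adj u v ≡ true) where
        M : ℤ
        M = energy (q u v)

        -- `energy-lower` makes `16 M` at least `(24/7) d³`, and `3 + 1/K < 24/7`.
        nd²<16M : + n * (+ d * + d) < + 16 * M
        nd²<16M = ≰⇒> λ 16M≤ → <⇒≱ (0<2Kd³) (by
          (7 · (K≥0 ⊗ gap 16M≤) ⊕ 8 · (K≥0 ⊗ gap (energy-lower u v uv))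
            ⊕ 7 · (0≤+ {d} ⊗ 0≤+ {d} ⊗ gap n≤3d)
            ⊕ (gap K≥952 ⊕ 0≤+ {945}) ⊗ (0≤+ {d} ⊗ 0≤+ {d} ⊗ 0≤+ {d}))
          (certificate K (+ n) (+ d) M))
          where
          0<2Kd³ : 0ℤ < + 2 * (K * (+ d * + d * + d))
          0<2Kd³ = _⊗⁺_ {+ 2} (+<+ z<s) (K>0 ⊗⁺ (d>0 ⊗⁺ d>0 ⊗⁺ d>0))
          certificate : ∀ K n d M →
            + 7 * (K * (n * (d * d) - + 16 * M)) + + 8 * (K * (+ 14 * M - + 3 * (d * d * d)))
            + + 7 * (d * d * ((+ 3 * K + 1ℤ) * d - K * n)) + (K - + 952 + + 945) * (d * d * d)
            ≡ 0ℤ - + 2 * (K * (d * d * d))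
          certificate = solve-∀

        φ-lower : ∀ x → 0ℤ ≤ φ u v x + + 4 * M
        φ-lower x = *-cancelˡ-≤-pos _ _ (+ 8) (by
          (square-sum 1ℤ (image (q u v)) (image (g x)) ⊕ gap (image-g-norm x) ⊕ gap (<⇒≤ nd²<16M))
          (certificate M (φ u v x) ⟨ image (g x) , image (g x) ⟩ (+ n * (+ d * + d))))
          where
          certificate : ∀ M φ c N → + 16 * M + (+ 8 * 1ℤ * φ + 1ℤ * 1ℤ * c) + (N - c) + (+ 16 * M - N) ≡
            + 8 * (φ + + 4 * M) - + 8 * 0ℤ
          certificate = solve-∀

        φ-upper : ∀ x → φ u v x + + 4 * M < + 8 * M
        φ-upper x = *-cancelˡ-<-nonNeg (+ 8) (suc[i]≤j⇒i<j (by
          (square-sum (- 1ℤ) (image (q u v)) (image (g x)) ⊕ gap (image-g-norm x) ⊕ gap< nd²<16M)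
          (certificate M (φ u v x) ⟨ image (g x) , image (g x) ⟩ (+ n * (+ d * + d)))))
          where
          certificate : ∀ M φ c N →
            + 16 * M + (+ 8 * - 1ℤ * φ + - 1ℤ * - 1ℤ * c) + (N - c) + (+ 16 * M - (1ℤ + N)) ≡
            + 8 * (+ 8 * M) - (1ℤ + + 8 * (φ + + 4 * M))
          certificate = solve-∀

        module _ (B : ℕ) (B≡8H : + B ≡ + 8 * H) where
          -- The shift by `4 M` moves the test values into [0, 8M). After scaling by `H` there are
          -- `8 H` buckets of width `M`, so test values in a common bucket differ by at most
          -- `M / H`.
          bucketOf : ∀ x → Bucket B M (H * (φ u v x + + 4 * M))
          bucketOf x = bucket B (<⇒≤ H>0 ⊗ φ-lower x) (begin-strict
            H * (φ u v x + + 4 * M) <⟨ *-monoˡ-<-pos H {{positive H>0}} (φ-upper x) ⟩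
            H * (+ 8 * M)           ≡⟨ rotate H M ⟩
            + 8 * H * M             ≡⟨ cong (_* M) B≡8H ⟨
            + B * M ∎)
            where
            open ≤-Reasoning
            rotate : ∀ H M → H * (+ 8 * M) ≡ + 8 * H * M
            rotate = solve-∀

          same-bucket : ∀ x y → proj₁ (bucketOf x) ≡ proj₁ (bucketOf y) → H * (φ u v x - φ u v y) ≤ M
          same-bucket x y eq = ≤-trans (≤-reflexive (difference H (φ u v x) (φ u v y) M))
            (same-bucket-close (bucketOf x) (bucketOf y) eq)
            where
            difference : ∀ H a b M → H * (a - b) ≡ H * (a + + 4 * M) - H * (b + + 4 * M)
            difference = solve-∀

      module _ (B k : ℕ) .{{_ : NonZero B}} (B≡8H : + B ≡ + 8 * H)
        (H≫k : + 904 * H < + 975 * (H - + 2 * + suc k)) (91≤k : + 91 ≤ + suc k) where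

        open Separation B k (λ u v uv x → proj₁ (bucketOf u v uv B B≡8H x))

        vector : Edge → Vector
        vector (u , v , _) = q u v

        -- The test of the older edge `e′` puts both ends of `e` into one bucket, and `φ-difference`
        -- turns this into a bound on the product of the images. Exchanging the ends gives the lower
        -- bound.
        unseparated⇒almostOrthogonal : ∀ {e e′} → Unseparated e e′ → AlmostOrthogonal (+ 2 * + d) (vector e) (vector e′)
        unseparated⇒almostOrthogonal {u , v , _} {u′ , v′ , u′v′} eq = record
          { images-lower = by (gap (same-bucket u′ v′ u′v′ B B≡8H v u (sym eq)))
              (trans (flip (energy (q u′ v′)) H (φ u′ v′ u) (φ u′ v′ v))
                (cong (λ z → H * z - - energy (q u′ v′)) (sym (φ-difference u′ v′ u v))))
          ; images-upper = subst (λ z → H * z ≤ energy (q u′ v′)) (sym (φ-difference u′ v′ u v))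
              (same-bucket u′ v′ u′v′ B B≡8H u v eq)
          ; inner-lower = q-inner-lower u v u′ v′
          ; inner-upper = q-inner-upper u v u′ v′
          }
          where
          flip : ∀ M H a b → M - H * (b - a) ≡ H * (a - b) - - M
          flip = solve-∀

        totalEnergy-lower : ∀ es → + 3 * (+ d * + d * + d) * + length es ≤ + 14 * totalEnergy (map vector es)
        totalEnergy-lower [] = ≤-reflexive (*-zeroʳ (+ 3 * (+ d * + d * + d)))
        totalEnergy-lower ((u , v , uv) ∷ es) =
          by (gap (energy-lower u v uv) ⊕ gap (totalEnergy-lower es))
             (certificate (+ d * + d * + d) (+ length es) (energy (q u v)) (totalEnergy (map vector es)))
          where
          certificate : ∀ d³ l e t → (+ 14 * e - + 3 * d³) + (+ 14 * t - + 3 * d³ * l) ≡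
            + 14 * (e + t) - + 3 * d³ * (1ℤ + l)
          certificate = solve-∀

        -- `(3 + 1/K)² = 9 + 6/K + 1/K²` is at most `226/25 = 9.04`.
        25n²≤226d² : + 25 * (+ n * + n) ≤ + 226 * (+ d * + d)
        25n²≤226d² = *-cancelˡ-≤-pos _ _ K {{positive K>0}} (*-cancelˡ-≤-pos _ _ K {{positive K>0}} (by
          (25 · (gap n≤3d ⊗ ((3 · K≥0 ⊕ 0≤+ {1}) ⊗ 0≤+ {d} ⊕ K≥0 ⊗ 0≤+ {n}))
            ⊕ (K≥0 ⊗ gap K≥952 ⊕ 801 · K≥0 ⊕ gap K≥952 ⊕ 0≤+ {927}) ⊗ (0≤+ {d} ⊗ 0≤+ {d}))
          (certificate K (+ n) (+ d))))
          where
          certificate : ∀ K n d →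
            + 25 * (((+ 3 * K + 1ℤ) * d - K * n) * ((+ 3 * K + 1ℤ) * d + K * n))
              + (K * (K - + 952) + + 801 * K + (K - + 952) + + 927) * (d * d)
            ≡ K * (K * (+ 226 * (d * d))) - K * (K * (+ 25 * (n * n)))
          certificate = solve-∀

        -- Here the length 91 enters: `91 · 3/14 = 39/2` exceeds `2 · 226/25 = 18.08`, with room
        -- left for the loss from the tolerance `1 / H`.
        39d³≤2E : ∀ es → length es ≡ suc k → + 39 * (+ d * + d * + d) ≤ + 2 * totalEnergy (map vector es)
        39d³≤2E es len = *-cancelˡ-≤-pos _ _ (+ 14) (by
          (2 · gap (subst (λ l → + 3 * (+ d * + d * + d) * + l ≤ + 14 * totalEnergy (map vector es)) len (totalEnergy-lower es))
            ⊕ 6 · (0≤+ {d} ⊗ 0≤+ {d} ⊗ 0≤+ {d} ⊗ gap 91≤k))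
          (certificate (+ d * + d * + d) (+ suc k) (totalEnergy (map vector es))))
          where
          certificate : ∀ d³ l e → + 2 * (+ 14 * e - + 3 * d³ * l) + + 6 * (d³ * (l - + 91)) ≡
            + 14 * (+ 2 * e) - + 14 * (+ 39 * d³)
          certificate = solve-∀

        H≥2k : + 2 * + suc k ≤ H
        H≥2k = 0≤i-j⇒j≤i (*-cancelˡ-≤-pos 0ℤ _ (+ 975) (<⇒≤ (≤-<-trans (904 · <⇒≤ H>0) H≫k)))

        bounded : ∀ es → AllPairs Unseparated es → length es ≢ suc k
        bounded es pairs len =
          energy-contradiction {H} {+ d} {+ n} {totalEnergy (map vector es)} {+ suc k} H>0 d>0 H≥2k H≫k 25n²≤226d² (39d³≤2E es len) bound
          where
          E : ℤ
          E = totalEnergy (map vector es)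
          pairs′ : AllPairs (AlmostOrthogonal (+ 2 * + d)) (map vector es)
          pairs′ = AllPairs.map⁺ (AllPairs.map (λ {e} {e′} → unseparated⇒almostOrthogonal {e} {e′}) pairs)
          norms : ∀ es → All (λ q → ⟨ q , q ⟩ ≤ + 2 * + d) (map vector es)
          norms [] = []
          norms ((u , v , _) ∷ es) = q-inner-upper u v u v ∷ norms es
          bound : + 2 * H * (+ 2 * + d) * E ≤
            H * (+ 2 * + d * (+ 2 * + d) * (+ n * + n)) + + 2 * + d * E * (H + + 2 * + suc k)
          bound = subst (λ l → + 2 * H * (+ 2 * + d) * E ≤
              H * (+ 2 * + d * (+ 2 * + d) * (+ n * + n)) + + 2 * + d * E * (H + + 2 * + l))
            (trans (length-map vector es) len)
            (energy-bound (+ 2 * + d) (map vector es) (+ 2 * + d) pairs′ (norms es) (2 · 0≤+ {d}))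

        bounded-degree-colouring : Colouring (B ℕ.^ k) (λ _ → true)
        bounded-degree-colouring = separate bounded

  -- Triangle-free graphs with a vertex of large degree

  module LargeDegree {n : ℕ} (adj : Fin n → Fin n → Bool)
    (adj-sym : ∀ {u v} → adj u v ≡ true → adj v u ≡ true)
    (triangle-free : ∀ {u v w} → adj u v ≡ true → adj v w ≡ true → adj u w ≡ true → ⊥)
    where
    open TriangleFree adj adj-sym triangle-free

    VertexSet : Set
    VertexSet = Fin n → Bool

    _∖_ : VertexSet → VertexSet → VertexSet
    (S ∖ T) v = S v ∧ not (T v)

    Independent : VertexSet → Set
    Independent S = ∀ {u v} → S u ≡ true → S v ≡ true → adj u v ≡ true → ⊥

    Colouring-mono : ∀ {k l S} → k ℕ.≤ l → Colouring k S → Colouring l S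
    Colouring-mono k≤l (c , proper) =
      (λ v → inject≤ (c v) k≤l) , λ u∈S v∈S uv eq → proper u∈S v∈S uv (inject≤-injective k≤l k≤l _ _ eq)

    colour-union : ∀ {k l S T U} → (∀ v → U v ≡ true → S v ≡ true ⊎ T v ≡ true) →
      Colouring k S → Colouring l T → Colouring (k ℕ.+ l) U
    colour-union {k} {l} {S} {T} {U} cover (c , c-proper) (e , e-proper) = colour , proper
      where
      colour : Fin n → Fin (k ℕ.+ l)
      colour v = if S v then c v ↑ˡ l else k ↑ʳ e v
      in-T : ∀ {v} → U v ≡ true → S v ≡ false → T v ≡ true
      in-T {v} v∈U v∉S with cover v v∈U
      ... | inj₁ v∈S = case trans (sym v∈S) v∉S of λ ()
      ... | inj₂ v∈T = v∈T
      ↑ˡ≢↑ʳ : ∀ {i : Fin k} {j : Fin l} → i ↑ˡ l ≢ k ↑ʳ j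
      ↑ˡ≢↑ʳ {i} {j} eq =
        case trans (sym (splitAt-↑ˡ k i l)) (trans (cong (Fin.splitAt k) eq) (splitAt-↑ʳ k l j)) of λ ()
      proper : ∀ {u v} → U u ≡ true → U v ≡ true → adj u v ≡ true → colour u ≢ colour v
      proper {u} {v} u∈U v∈U uv eq with S u in Su | S v in Sv
      ... | true  | true  = c-proper Su Sv uv (↑ˡ-injective l _ _ eq)
      ... | true  | false = ↑ˡ≢↑ʳ eq
      ... | false | true  = ↑ˡ≢↑ʳ (sym eq)
      ... | false | false = e-proper (in-T u∈U Su) (in-T v∈U Sv) uv (↑ʳ-injective k _ _ eq)

    colour-independent : ∀ {S} → Independent S → Colouring 1 S
    colour-independent ind = (λ _ → zero) , λ u∈S v∈S uv _ → ind u∈S v∈S uv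

    ∧-true : ∀ {a b} → a ∧ b ≡ true → a ≡ true × b ≡ true
    ∧-true {true} {true} _ = refl , refl

    ∖-cover : ∀ (S T : VertexSet) v → S v ≡ true → T v ≡ true ⊎ (S ∖ T) v ≡ true
    ∖-cover S T v v∈S with T v
    ... | true  = inj₁ refl
    ... | false rewrite v∈S = inj₂ refl

    -- A neighbourhood is independent, so removing it costs one colour.
    colour-remove-neighbours : ∀ {k S} x → Colouring k (S ∖ adj x) → Colouring (suc k) S
    colour-remove-neighbours {S = S} x = colour-union (∖-cover S (adj x))
      (colour-independent λ xu xv uv → triangle-free xu uv xv)

    degIn : VertexSet → Fin n → ℤ
    degIn S y = ∑ λ i → ⟦ adj y i ⟧ * ⟦ S i ⟧

    adj-comm : ∀ u v → adj u v ≡ adj v u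
    adj-comm u v with adj u v in uv | adj v u in vu
    ... | true  | true  = refl
    ... | false | false = refl
    ... | true  | false = trans (sym (adj-sym uv)) vu
    ... | false | true  = trans (sym uv) (adj-sym vu)

    degIn-comm : ∀ S T → ∑ (λ x → ⟦ S x ⟧ * degIn T x) ≡ ∑ (λ y → ⟦ T y ⟧ * degIn S y)
    degIn-comm S T = begin
      ∑ (λ x → ⟦ S x ⟧ * degIn T x)
        ≡⟨ ∑-cong (λ x → sym (∑-*ˡ ⟦ S x ⟧ _)) ⟩
      ∑ (λ x → ∑ λ y → ⟦ S x ⟧ * (⟦ adj x y ⟧ * ⟦ T y ⟧))
        ≡⟨ ∑-comm _ ⟩
      ∑ (λ y → ∑ λ x → ⟦ S x ⟧ * (⟦ adj x y ⟧ * ⟦ T y ⟧))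
        ≡⟨ ∑-cong (λ y → trans (∑-cong λ x → trans (cong (λ a → ⟦ S x ⟧ * (⟦ a ⟧ * ⟦ T y ⟧)) (adj-comm x y))
              (rotate ⟦ S x ⟧ ⟦ adj y x ⟧ ⟦ T y ⟧)) (∑-*ˡ ⟦ T y ⟧ _)) ⟩
      ∑ (λ y → ⟦ T y ⟧ * degIn S y) ∎
      where
      open ≡-Reasoning
      rotate : ∀ a b c → a * (b * c) ≡ c * (b * a)
      rotate = solve-∀

    size-∖ : ∀ S x → size (S ∖ adj x) ≡ size S - degIn S x
    size-∖ S x = trans (∑-cong λ i → pointwise (S i) (adj x i)) (∑-distrib-- _ _)
      where
      pointwise : ∀ s a → ⟦ s ∧ not a ⟧ ≡ ⟦ s ⟧ - ⟦ a ⟧ * ⟦ s ⟧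
      pointwise true  true  = refl
      pointwise true  false = refl
      pointwise false true  = refl
      pointwise false false = refl

    -- The assumption on Kneser graphs enters only through `kneser`, which t-colours at most f
    -- vertices having P neighbours each in a set of at most 2P + 21f vertices.
    module NearlyBipartite (P f t : ℕ) (z : Fin n)
      (min-degree : ∀ v → + P + + 9 * + f ≤ deg v)
      (n≤ : + n ≤ + 3 * (+ P + + 10 * + f))
      (P≥42f : + 42 * + f ≤ + P)
      (large-degree : + 5 * + n + + 30 * + f < + 9 * deg z)
      (kneser : ∀ (X R : VertexSet) → size X ≤ + 2 * + P + + 21 * + f →
        (∀ y → R y ≡ true → + P ≤ degIn X y) → size R ≤ + f → Colouring t R)
      where

      d : ℤ
      d = + P + + 9 * + f

      Y? : ∀ v → _
      Y? v = any? λ i → (adj v i Bool.≟ true) ×-dec (adj z i Bool.≟ true)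

      Y X : VertexSet
      Y v = does (Y? v)
      X v = not (Y v)

      Y⇒common-neighbour : ∀ {v} → Y v ≡ true → ∃[ i ] adj v i ≡ true × adj z i ≡ true
      Y⇒common-neighbour {v} v∈Y with Y? v
      ... | yes p = p

      X⇒no-common-neighbour : ∀ {v i} → X v ≡ true → adj v i ≡ true → adj z i ≡ true → ⊥
      X⇒no-common-neighbour {v} {i} v∈X vi zi with Y? v
      X⇒no-common-neighbour () vi zi | yes _
      ... | no none = none (i , vi , zi)

      X-or-Y : ∀ v → X v ≡ true ⊎ Y v ≡ true
      X-or-Y v with Y v
      ... | true  = inj₂ refl
      ... | false = inj₁ refl

      N⊆X : ∀ v → adj z v ≡ true → X v ≡ true
      N⊆X v zv with X-or-Y v
      ... | inj₁ v∈X = v∈X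
      ... | inj₂ v∈Y with i , vi , zi ← Y⇒common-neighbour v∈Y = ⊥-elim (triangle-free zv vi zi)

      size-X+Y : size X + size Y ≡ + n
      size-X+Y = trans (sym (∑-distrib-+ _ _)) (trans (∑-cong λ v → pointwise (Y v))
        (trans (∑-const n 1ℤ) (*-identityʳ (+ n))))
        where
        pointwise : ∀ b → ⟦ not b ⟧ + ⟦ b ⟧ ≡ 1ℤ
        pointwise true  = refl
        pointwise false = refl

      size-X-lower : + 5 * + n + + 30 * + f < + 9 * size X
      size-X-lower = <-≤-trans large-degree (*-monoˡ-≤-nonNeg (+ 9) (size-mono N⊆X))

      -- For an edge `uv` inside `X` the neighbourhoods of `u`, `v` and `z` are pairwise disjoint,
      -- but the lower bounds on their sizes add up to more than n.
      X-independent : Independent X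
      X-independent {u} {v} u∈X v∈X uv = absurdBy
        (gap< large-degree ⊕ 9 · gap three-disjoint ⊕ 9 · gap (min-degree u) ⊕ 9 · gap (min-degree v) ⊕ 4 · gap n≤ ⊕ 6 · 0≤+ {P} ⊕ 72 · 0≤+ {f})
        (certificate (+ n) (+ P) (+ f) (deg u) (deg v) (deg z))
        where
        pointwise : ∀ i → ⟦ adj u i ⟧ + ⟦ adj v i ⟧ + ⟦ adj z i ⟧ ≤ 1ℤ
        pointwise i with adj u i in ui | adj v i in vi | adj z i in zi
        ... | true  | true  | _     = ⊥-elim (triangle-free uv vi ui)
        ... | true  | false | true  = ⊥-elim (X⇒no-common-neighbour u∈X ui zi)
        ... | false | true  | true  = ⊥-elim (X⇒no-common-neighbour v∈X vi zi)
        ... | true  | false | false = ≤-refl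
        ... | false | true  | false = ≤-refl
        ... | false | false | true  = ≤-refl
        ... | false | false | false = +≤+ z≤n
        three-disjoint : deg u + deg v + deg z ≤ + n
        three-disjoint = ≤-trans
          (≤-reflexive (trans (cong (_+ deg z) (sym (∑-distrib-+ _ _))) (sym (∑-distrib-+ _ _))))
          (≤-trans (∑-mono pointwise) (≤-reflexive (trans (∑-const n 1ℤ) (*-identityʳ (+ n)))))
        certificate : ∀ n p f a b c →
          (+ 9 * c - (1ℤ + (+ 5 * n + + 30 * f))) + + 9 * (n - (a + b + c))
          + + 9 * (a - (p + + 9 * f)) + + 9 * (b - (p + + 9 * f)) + + 4 * (+ 3 * (p + + 10 * f) - n)
          + + 6 * p + + 72 * f ≡ - 1ℤ
        certificate = solve-∀

      N[X]⊆Y : ∀ {x i} → X x ≡ true → adj x i ≡ true → Y i ≡ true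
      N[X]⊆Y {x} {i} x∈X xi with X-or-Y i
      ... | inj₁ i∈X = ⊥-elim (X-independent x∈X i∈X xi)
      ... | inj₂ i∈Y = i∈Y

      Y⇒neighbour-in-X : ∀ {y} → Y y ≡ true → ∃[ x ] X x ≡ true × adj y x ≡ true
      Y⇒neighbour-in-X y∈Y with x , yx , zx ← Y⇒common-neighbour y∈Y = x , N⊆X x zx , yx

      -- Some `x` in `X` is adjacent to `y`. Its neighbours, at least `d` many, lie in `Y` because
      -- `X` is independent, and none of them is adjacent to `y`.
      degIn-Y-upper : ∀ y → Y y ≡ true → degIn Y y ≤ size Y - d
      degIn-Y-upper y y∈Y with x , x∈X , yx ← Y⇒neighbour-in-X y∈Y =
        by (gap disjoint ⊕ gap (min-degree x)) (certificate (degIn Y y) (deg x) (size Y) d)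
        where
        pointwise : ∀ i → ⟦ adj y i ⟧ * ⟦ Y i ⟧ + ⟦ adj x i ⟧ ≤ ⟦ Y i ⟧
        pointwise i with adj y i in yi | adj x i in xi
        ... | true  | true  = ⊥-elim (triangle-free yx xi yi)
        ... | true  | false = ≤-reflexive (trans (+-identityʳ _) (*-identityˡ ⟦ Y i ⟧))
        ... | false | false = ⟦⟧≥0 (Y i)
        ... | false | true rewrite N[X]⊆Y x∈X xi = ≤-refl
        disjoint : degIn Y y + deg x ≤ size Y
        disjoint = ≤-trans (≤-reflexive (sym (∑-distrib-+ _ _))) (∑-mono pointwise)
        certificate : ∀ a b c d → (c - (a + b)) + (b - d) ≡ c - d - a
        certificate = solve-∀

      degIn-X+Y : ∀ y → degIn X y + degIn Y y ≡ deg y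
      degIn-X+Y y = trans (sym (∑-distrib-+ _ _)) (∑-cong λ i → pointwise ⟦ adj y i ⟧ (Y i))
        where
        pointwise : ∀ a b → a * ⟦ not b ⟧ + a * ⟦ b ⟧ ≡ a
        pointwise a true  = trans (cong (_+ a * 1ℤ) (*-zeroʳ a)) (trans (+-identityˡ _) (*-identityʳ a))
        pointwise a false = trans (cong (_+_ (a * 1ℤ)) (*-zeroʳ a)) (trans (+-identityʳ _) (*-identityʳ a))

      degIn-X-lower : ∀ y → Y y ≡ true → + 2 * d - size Y ≤ degIn X y
      degIn-X-lower y y∈Y = by (gap (degIn-Y-upper y y∈Y) ⊕ gap (min-degree y))
        (trans (cong (λ e → size Y - d - degIn Y y + (e - d)) (sym (degIn-X+Y y)))
               (certificate (degIn X y) (degIn Y y) (size Y) d))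
        where
        certificate : ∀ a b c d → c - d - b + (a + b - d) ≡ a - (+ 2 * d - c)
        certificate = solve-∀

      ∑ₗ : (Fin n → ℤ) → List (Fin n) → ℤ
      ∑ₗ h []       = 0ℤ
      ∑ₗ h (y ∷ ys) = h y + ∑ₗ h ys

      ∑ₗ-degIn : ∀ S ys → ∑ₗ (degIn S) ys ≡ ∑ (λ x → ∑ₗ (λ y → ⟦ adj y x ⟧) ys * ⟦ S x ⟧)
      ∑ₗ-degIn S [] = sym (trans (∑-cong λ x → *-zeroˡ ⟦ S x ⟧) (trans (∑-const n 0ℤ) (*-zeroʳ (+ n))))
      ∑ₗ-degIn S (y ∷ ys) = trans (cong (_+_ (degIn S y)) (∑ₗ-degIn S ys)) (trans (sym (∑-distrib-+ _ _))
        (∑-cong λ x → sym (*-distribʳ-+ ⟦ S x ⟧ ⟦ adj y x ⟧ _)))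

      -- Counting the edges to `X` twice gives `10 d ≤ 2|X| + 5|Y| = 5n - 3|X|`. As
      -- `|X| > (5n + 30f)/9` and `n ≤ 3d + 3f`, the right side is below `10 d`. This excludes both
      -- closed walks of length five and five high vertices with disjoint neighbourhoods in `Y`.
      five-in-Y : ∀ ys → length ys ≡ 5 → All (λ y → Y y ≡ true) ys →
        (∀ x → X x ≡ true → ∑ₗ (λ y → ⟦ adj y x ⟧) ys ≤ + 2) → ⊥
      five-in-Y ys len ys⊆Y sparse = absurdBy
        (3 · gap lower ⊕ 3 · gap upper ⊕ gap< size-X-lower ⊕ 10 · gap n≤)
        (trans (cong (λ m → + 3 * (s - + 5 * (+ 2 * d - size Y)) + + 3 * (+ 2 * size X - s)
                          + (+ 9 * size X - (1ℤ + (+ 5 * m + + 30 * + f))) + + 10 * (+ 3 * (+ P + + 10 * + f) - m)) (sym size-X+Y))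
               (certificate s (size X) (size Y) (+ P) (+ f)))
        where
        s : ℤ
        s = ∑ₗ (degIn X) ys
        sum-lower : ∀ ys → All (λ y → Y y ≡ true) ys → + length ys * (+ 2 * d - size Y) ≤ ∑ₗ (degIn X) ys
        sum-lower [] [] = ≤-reflexive (*-zeroˡ (+ 2 * d - size Y))
        sum-lower (y ∷ ys) (y∈Y ∷ ys⊆Y) = ≤-trans (≤-reflexive (suc-* (+ length ys) (+ 2 * d - size Y)))
          (+-mono-≤ (degIn-X-lower y y∈Y) (sum-lower ys ys⊆Y))
        lower : + 5 * (+ 2 * d - size Y) ≤ s
        lower = subst (λ l → + l * (+ 2 * d - size Y) ≤ s) len (sum-lower ys ys⊆Y)
        pointwise : ∀ x → ∑ₗ (λ y → ⟦ adj y x ⟧) ys * ⟦ X x ⟧ ≤ + 2 * ⟦ X x ⟧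
        pointwise x with X x in x∈X
        ... | true  = *-monoʳ-≤-nonNeg 1ℤ (sparse x x∈X)
        ... | false = ≤-reflexive (*-zeroʳ (∑ₗ (λ y → ⟦ adj y x ⟧) ys))
        upper : s ≤ + 2 * size X
        upper = ≤-trans (≤-reflexive (∑ₗ-degIn X ys)) (≤-trans (∑-mono pointwise) (≤-reflexive (∑-*ˡ (+ 2) _)))
        certificate : ∀ s x y p f →
          + 3 * (s - + 5 * (+ 2 * (p + + 9 * f) - y)) + + 3 * (+ 2 * x - s)
          + (+ 9 * x - (1ℤ + (+ 5 * (x + y) + + 30 * f))) + + 10 * (+ 3 * (p + + 10 * f) - (x + y)) ≡ - 1ℤ
        certificate = solve-∀

      X-inhabited : ∃[ x ] X x ≡ true
      X-inhabited with any? (λ v → X v Bool.≟ true)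
      ... | yes p = p
      ... | no none = ⊥-elim (<⇒≱ size-X-lower
        (≤-trans (*-monoˡ-≤-nonNeg (+ 9) (≤-trans (∑-mono λ v → empty v) (≤-reflexive (trans (∑-const n 0ℤ) (*-zeroʳ (+ n))))))
                 (5 · 0≤+ {n} ⊕ 30 · 0≤+ {f})))
        where
        empty : ∀ v → ⟦ X v ⟧ ≤ 0ℤ
        empty v with X v in v∈X
        ... | true  = ⊥-elim (none (v , v∈X))
        ... | false = ≤-refl

      size-Y-∖ : ∀ x → X x ≡ true → size (Y ∖ adj x) ≤ size Y - d
      size-Y-∖ x x∈X = ≤-trans (≤-reflexive (size-∖ Y x))
        (by (gap (min-degree x)) (trans (cong (_- d) deg≡) (certificate (size Y) d (degIn Y x))))
        where
        certificate : ∀ y d e → e - d ≡ y - d - (y - e)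
        certificate = solve-∀
        pointwise : ∀ i → ⟦ adj x i ⟧ ≡ ⟦ adj x i ⟧ * ⟦ Y i ⟧
        pointwise i with adj x i in xi
        ... | true rewrite N[X]⊆Y x∈X xi = refl
        ... | false = sym (*-zeroˡ ⟦ Y i ⟧)
        deg≡ : deg x ≡ degIn Y x
        deg≡ = ∑-cong pointwise

      d≤size-Y : d ≤ size Y
      d≤size-Y with x , x∈X ← X-inhabited =
        ≤-trans (min-degree x) (size-mono λ i → N[X]⊆Y x∈X)

      -- The bound is the size of the ground set of the Kneser graph: of at most 3P + 30f vertices,
      -- at least P + 9f lie in `Y`.
      size-X-upper : size X ≤ + 2 * + P + + 21 * + f
      size-X-upper = by (gap n≤ ⊕ gap d≤size-Y) (trans
        (cong (λ m → + 3 * (+ P + + 10 * + f) - m + (size Y - d)) (sym size-X+Y))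
        (certificate (size X) (size Y) (+ P) (+ f)))
        where
        certificate : ∀ x y p f → + 3 * (p + + 10 * f) - (x + y) + (y - (p + + 9 * f)) ≡ + 2 * p + + 21 * f - x
        certificate = solve-∀

      -- The case of a small Y

      module Sparse (size-Y-upper : size Y ≤ d + + 9 * + f) where

        degIn-X≥P : ∀ y → Y y ≡ true → + P ≤ degIn X y
        degIn-X≥P y y∈Y = ≤-trans (by (gap size-Y-upper) (certificate (size Y) (+ P) (+ f))) (degIn-X-lower y y∈Y)
          where
          certificate : ∀ y p f → p + + 9 * f + + 9 * f - y ≡ + 2 * (p + + 9 * f) - y - p
          certificate = solve-∀

        -- The average over X works, as P ≥ 2/5 (2P + 21f).
        shrink : ∀ R → (∀ v → R v ≡ true → Y v ≡ true) →
          ∃[ x ] X x ≡ true × + 5 * size (R ∖ adj x) ≤ + 3 * size R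
        shrink R R⊆Y with any? (λ x → (X x Bool.≟ true) ×-dec (+ 5 * size (R ∖ adj x) ≤? + 3 * size R))
        ... | yes found = found
        ... | no  none  = ⊥-elim (<⇒≱ size-X>0 (by
          (gap counted ⊕ 5 · gap double-count ⊕ 2 · (size≥0 R ⊗ gap size-X-upper) ⊕ size≥0 R ⊗ gap P≥42f)
          (certificate (size X) (size R) (∑ (λ x → ⟦ X x ⟧ * degIn R x)) (+ P) (+ f))))
          where
          size-X>0 : 0ℤ < size X
          size-X>0 = *-cancelˡ-<-nonNeg (+ 9) (≤-<-trans (5 · 0≤+ {n} ⊕ 30 · 0≤+ {f}) size-X-lower)
          pointwise : ∀ x → ⟦ X x ⟧ + + 5 * (⟦ X x ⟧ * degIn R x) ≤ ⟦ X x ⟧ * (+ 2 * size R)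
          pointwise x with X x in x∈X
          ... | false = ≤-reflexive (cong (λ z → 0ℤ + + 5 * z) (*-zeroˡ (degIn R x)))
          ... | true  = by
            (gap< (≰⇒> λ le → none (x , x∈X , le)))
            (trans (cong (λ z → + 5 * z - (1ℤ + + 3 * size R)) (size-∖ R x)) (certificate′ (size R) (degIn R x)))
            where
            certificate′ : ∀ r e → + 5 * (r - e) - (1ℤ + + 3 * r) ≡ 1ℤ * (+ 2 * r) - (1ℤ + + 5 * (1ℤ * e))
            certificate′ = solve-∀
          counted : size X + + 5 * ∑ (λ x → ⟦ X x ⟧ * degIn R x) ≤ size X * (+ 2 * size R)
          counted = ≤-trans
            (≤-reflexive (trans (cong (_+_ (size X)) (sym (∑-*ˡ (+ 5) _))) (sym (∑-distrib-+ _ _))))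
            (≤-trans (∑-mono pointwise) (≤-reflexive (∑-*ʳ (+ 2 * size R) _)))
          double-count : size R * + P ≤ ∑ (λ x → ⟦ X x ⟧ * degIn R x)
          double-count = ≤-trans (≤-reflexive (sym (∑-*ʳ (+ P) _)))
            (≤-trans (∑-mono bound) (≤-reflexive (sym (degIn-comm X R))))
            where
            bound : ∀ y → ⟦ R y ⟧ * + P ≤ ⟦ R y ⟧ * degIn X y
            bound y with R y in y∈R
            ... | true  = *-monoˡ-≤-nonNeg 1ℤ (degIn-X≥P y (R⊆Y y y∈R))
            ... | false = ≤-refl
          certificate : ∀ x r e p f →
            (x * (+ 2 * r) - (x + + 5 * e)) + + 5 * (e - r * p) + + 2 * (r * (+ 2 * p + + 21 * f - x)) + r * (p - + 42 * f)
            ≡ 0ℤ - x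
          certificate = solve-∀

        -- Every removal costs one colour and keeps at most 3/5 of the set. The continuation `small`
        -- colours what is left after `j` removals.
        remainder : ∀ j R → (∀ v → R v ≡ true → Y v ≡ true) →
          (∀ R′ → (∀ v → R′ v ≡ true → Y v ≡ true) →
            + (5 ℕ.^ j) * size R′ ≤ + (3 ℕ.^ j) * size R → Colouring t R′) →
          Colouring (j ℕ.+ t) R
        remainder zero R R⊆Y small = small R R⊆Y ≤-refl
        remainder (suc j) R R⊆Y small with x , _ , shrunk ← shrink R R⊆Y =
          colour-remove-neighbours x (remainder j (R ∖ adj x)
            (λ v v∈ → R⊆Y v (proj₁ (∧-true v∈)))
            (λ R′ R′⊆Y bound → small R′ R′⊆Y (begin
              + (5 ℕ.^ suc j) * size R′
                ≡⟨ trans (cong (_* size R′) (pos-* 5 (5 ℕ.^ j))) (*-assoc (+ 5) (+ (5 ℕ.^ j)) (size R′)) ⟩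
              + 5 * (+ (5 ℕ.^ j) * size R′)
                ≤⟨ *-monoˡ-≤-nonNeg (+ 5) bound ⟩
              + 5 * (+ (3 ℕ.^ j) * size (R ∖ adj x))
                ≡⟨ swap (+ 5) (+ (3 ℕ.^ j)) (size (R ∖ adj x)) ⟩
              + (3 ℕ.^ j) * (+ 5 * size (R ∖ adj x))
                ≤⟨ *-monoˡ-≤-nonNeg (+ (3 ℕ.^ j)) shrunk ⟩
              + (3 ℕ.^ j) * (+ 3 * size R)
                ≡⟨ trans (swap (+ (3 ℕ.^ j)) (+ 3) (size R)) (trans (sym (*-assoc (+ 3) (+ (3 ℕ.^ j)) (size R)))
                     (cong (_* size R) (sym (pos-* 3 (3 ℕ.^ j))))) ⟩
              + (3 ℕ.^ suc j) * size R ∎)))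
          where
          open ≤-Reasoning
          swap : ∀ a b c → a * (b * c) ≡ b * (a * c)
          swap = solve-∀

        sparse-colouring : Colouring (7 ℕ.+ t) (λ _ → true)
        sparse-colouring with x , x∈X ← X-inhabited =
          colour-union (λ v _ → X-or-Y v) (colour-independent X-independent)
            -- Removing one neighbourhood leaves at most 9f vertices of `Y`. As 9 · 243 = 2187 is at
            -- most 3125, five more removals leave at most f. With `X` this costs seven colours.
            (colour-remove-neighbours x (remainder 5 (Y ∖ adj x) (λ v v∈ → proj₁ (∧-true v∈))
              λ R R⊆Y bound → kneser X R size-X-upper (λ y y∈R → degIn-X≥P y (R⊆Y y y∈R))
                (*-cancelˡ-≤-pos _ _ (+ 3125) (≤-trans bound (≤-trans (*-monoˡ-≤-nonNeg (+ 243) initial)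
                  (≤-trans (≤-reflexive (sym (*-assoc (+ 243) (+ 9) (+ f))))
                    (*-monoʳ-≤-nonNeg (+ f) (+≤+ (ℕ.m≤m+n 2187 938)))))))))
          where
          initial : size (Y ∖ adj x) ≤ + 9 * + f
          initial = ≤-trans (size-Y-∖ x x∈X) (by (gap size-Y-upper) (certificate (size Y) d (+ f)))
            where
            certificate : ∀ y d f → d + + 9 * f - y ≡ + 9 * f - (y - d)
            certificate = solve-∀

      -- Common neighbours in Y, and the case of a large Y

      Meet : Fin n → Fin n → Set
      Meet c y = ∃[ m ] adj c m ≡ true × adj y m ≡ true × Y m ≡ true

      meet? : ∀ c y → _
      meet? c y = any? λ m → (adj c m Bool.≟ true) ×-dec ((adj y m Bool.≟ true) ×-dec (Y m Bool.≟ true))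

      meet : Fin n → VertexSet
      meet c y = does (meet? c y)

      meet⇒Meet : ∀ {c y} → meet c y ≡ true → Meet c y
      meet⇒Meet {c} {y} eq with meet? c y
      ... | yes p = p

      not-meet⇒¬Meet : ∀ {c y} → not (meet c y) ≡ true → ¬ Meet c y
      not-meet⇒¬Meet {c} {y} eq with meet? c y
      not-meet⇒¬Meet () | yes _
      ... | no ¬p = ¬p

      -- A closed walk of length five in Y meets every N(x), x ∈ X, at most twice.
      meet-independent : ∀ c → Y c ≡ true → ∀ {y y′} → Y y ≡ true → Y y′ ≡ true →
        meet c y ≡ true → meet c y′ ≡ true → adj y y′ ≡ true → ⊥
      meet-independent c c∈Y {y} {y′} y∈Y y′∈Y cy cy′ yy′
        with m , cm , ym , m∈Y ← meet⇒Meet {c} {y} cy | m′ , cm′ , y′m′ , m′∈Y ← meet⇒Meet {c} {y′} cy′ =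
        five-in-Y (y ∷ m ∷ c ∷ m′ ∷ y′ ∷ []) refl (y∈Y ∷ m∈Y ∷ c∈Y ∷ m′∈Y ∷ y′∈Y ∷ [])
          λ x _ → ≮⇒≥ λ gt → absurdBy
            (2 · gap< gt ⊕ gap (edge x ym) ⊕ gap (edge x cm) ⊕ gap (edge x cm′) ⊕ gap (edge x y′m′) ⊕ gap (edge x yy′))
            (certificate ⟦ adj y x ⟧ ⟦ adj m x ⟧ ⟦ adj c x ⟧ ⟦ adj m′ x ⟧ ⟦ adj y′ x ⟧)
        where
        edge : ∀ x {u v} → adj u v ≡ true → ⟦ adj u x ⟧ + ⟦ adj v x ⟧ ≤ 1ℤ
        edge x {u} {v} uv with adj u x in ux | adj v x in vx
        ... | true  | true  = ⊥-elim (triangle-free uv vx ux)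
        ... | true  | false = ≤-refl
        ... | false | true  = ≤-refl
        ... | false | false = +≤+ z≤n
        certificate : ∀ y m c k w →
          + 2 * (y + (m + (c + (k + (w + 0ℤ)))) - (1ℤ + + 2)) + (1ℤ - (y + m)) + (1ℤ - (c + m)) + (1ℤ - (c + k))
          + (1ℤ - (w + k)) + (1ℤ - (y + w)) ≡ - 1ℤ
        certificate = solve-∀

      module Dense (size-Y-lower : d + + 9 * + f < size Y) where

        high low : VertexSet
        high y = Y y ∧ does (size Y - d <? + 3 * degIn Y y)
        low = Y ∖ high

        high⇒ : ∀ {y} → high y ≡ true → Y y ≡ true × size Y - d < + 3 * degIn Y y
        high⇒ {y} y∈H with Y y | size Y - d <? + 3 * degIn Y y
        ... | true | yes p = refl , p

        low⇒ : ∀ {y} → low y ≡ true → Y y ≡ true × + 3 * degIn Y y ≤ size Y - d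
        low⇒ {y} y∈L with Y y | size Y - d <? + 3 * degIn Y y
        ... | true | no ¬p = refl , ≮⇒≥ ¬p

        -- Put `s = size Y - d`. Adjacent `y` and `y′` have disjoint neighbourhoods in `X`, each
        -- with at least `d - s/3` elements, but `X` has at most `2d + 3f - s`, which is too few as
        -- `s > 9f`.
        low-independent : Independent low
        low-independent {y} {y′} y∈L y′∈L yy′
          with y∈Y , y-low ← low⇒ {y} y∈L | y′∈Y , y′-low ← low⇒ {y′} y′∈L = absurdBy
          (gap< size-Y-lower ⊕ gap y-low ⊕ gap y′-low ⊕ 3 · gap disjoint
            ⊕ 3 · gap (≤-trans (min-degree y) (≤-reflexive (sym (degIn-X+Y y))))
            ⊕ 3 · gap (≤-trans (min-degree y′) (≤-reflexive (sym (degIn-X+Y y′)))) ⊕ 3 · gap n≤)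
          (trans (cong (λ m → size Y - (1ℤ + (d + + 9 * + f)) + (size Y - d - + 3 * degIn Y y) + (size Y - d - + 3 * degIn Y y′)
                + + 3 * (size X - (degIn X y + degIn X y′)) + + 3 * (degIn X y + degIn Y y - d)
                + + 3 * (degIn X y′ + degIn Y y′ - d) + + 3 * (+ 3 * (+ P + + 10 * + f) - m)) (sym size-X+Y))
            (certificate (size X) (size Y) (degIn X y) (degIn X y′) (degIn Y y) (degIn Y y′) (+ P) (+ f)))
          where
          pointwise : ∀ i → ⟦ adj y i ⟧ * ⟦ X i ⟧ + ⟦ adj y′ i ⟧ * ⟦ X i ⟧ ≤ ⟦ X i ⟧
          pointwise i with adj y i in yi | adj y′ i in y′i
          ... | true  | true  = ⊥-elim (triangle-free yy′ y′i yi)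
          ... | true  | false = ≤-reflexive (trans (+-identityʳ _) (*-identityˡ ⟦ X i ⟧))
          ... | false | true  = ≤-reflexive (trans (+-identityˡ _) (*-identityˡ ⟦ X i ⟧))
          ... | false | false = ⟦⟧≥0 (X i)
          disjoint : degIn X y + degIn X y′ ≤ size X
          disjoint = ≤-trans (≤-reflexive (sym (∑-distrib-+ _ _))) (∑-mono pointwise)
          certificate : ∀ x y a b c e p f →
            y - (1ℤ + (p + + 9 * f + + 9 * f)) + (y - (p + + 9 * f) - + 3 * c) + (y - (p + + 9 * f) - + 3 * e)
            + + 3 * (x - (a + b)) + + 3 * (a + c - (p + + 9 * f)) + + 3 * (b + e - (p + + 9 * f))
            + + 3 * (+ 3 * (p + + 10 * f) - (x + y)) ≡ - 1ℤ
          certificate = solve-∀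

        -- A vertex of `Q` is picked, all vertices meeting it form one colour class, and the search
        -- continues among the others. If a vertex is available k + 1 times, the picked ones have
        -- pairwise disjoint neighbourhoods in `Y`; otherwise there are at most k classes, and one
        -- more colour is allotted to the empty rest.
        greedy : ∀ k Q → (∀ v → Q v ≡ true → high v ≡ true) →
          Colouring (suc k) Q ⊎
          Σ[ ys ∈ List (Fin n) ] length ys ≡ suc k × All (λ y → Q y ≡ true) ys × AllPairs (λ c y → ¬ Meet c y) ys
        greedy k Q Q⊆H with any? (λ y → Q y Bool.≟ true)
        ... | no none = inj₁ ((λ _ → zero) , λ {u} u∈Q _ _ _ → none (u , u∈Q))
        greedy zero Q Q⊆H | yes (y , y∈Q) = inj₂ (y ∷ [] , refl , y∈Q ∷ [] , [] ∷ [])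
        greedy (suc k) Q Q⊆H | yes (y , y∈Q)
          with greedy k (Q ∖ meet y) (λ v v∈ → Q⊆H v (proj₁ (∧-true v∈)))
        ... | inj₁ colouring = inj₁ (colour-union cover (colour-independent class-independent) colouring)
          where
          class : VertexSet
          class v = Q v ∧ meet y v
          cover : ∀ v → Q v ≡ true → class v ≡ true ⊎ (Q ∖ meet y) v ≡ true
          cover v v∈Q rewrite v∈Q with meet y v
          ... | true  = inj₁ refl
          ... | false = inj₂ refl
          Q⇒Y : ∀ {v} → Q v ≡ true → Y v ≡ true
          Q⇒Y {v} v∈Q = proj₁ (high⇒ {v} (Q⊆H v v∈Q))
          class-independent : Independent class
          class-independent {u} {v} u∈ v∈ = meet-independent y (Q⇒Y y∈Q)
            (Q⇒Y (proj₁ (∧-true {Q u} u∈))) (Q⇒Y (proj₁ (∧-true {Q v} v∈)))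
            (proj₂ (∧-true {Q u} u∈)) (proj₂ (∧-true {Q v} v∈))
        ... | inj₂ (ys , len , ys⊆ , pairs) = inj₂
          (y ∷ ys , cong suc len , y∈Q ∷ All.map (λ {v} v∈ → proj₁ (∧-true {Q v} v∈)) ys⊆ ,
           All.map (λ {v} v∈ → not-meet⇒¬Meet {y} {v} (proj₂ (∧-true {Q v} v∈))) ys⊆ ∷ pairs)

        -- Suppose some `x` in `X` is adjacent to three of them. Their neighbourhoods in `Y` are
        -- larger than `s/3`, with `s = size Y - d`, and are disjoint from each other and from that
        -- of `x`, so `Y` has more than `s + d` elements. Hence every `x` is adjacent to at most
        -- two, and `five-in-Y` applies.
        no-five-disjoint : ∀ ys → length ys ≡ 5 → All (λ y → high y ≡ true) ys → AllPairs (λ c y → ¬ Meet c y) ys → ⊥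
        no-five-disjoint ys len ys⊆H pairs = five-in-Y ys len (All.map (λ {y} y∈H → proj₁ (high⇒ {y} y∈H)) ys⊆H) sparse
          where
          s≥0 : 0ℤ ≤ size Y - d
          s≥0 = by (gap< size-Y-lower ⊕ 9 · 0≤+ {f} ⊕ 0≤+ {1}) (certificate (size Y) d (+ f))
            where
            certificate : ∀ y d f → y - (1ℤ + (d + + 9 * f)) + + 9 * f + 1ℤ ≡ y - d - 0ℤ
            certificate = solve-∀
          sparse : ∀ x → X x ≡ true → ∑ₗ (λ y → ⟦ adj y x ⟧) ys ≤ + 2
          sparse x x∈X = ≮⇒≥ λ gt → absurdBy
            ((0≤+ {1} ⊕ s≥0) ⊗ gap< gt ⊕ gap (weights ys ys⊆H) ⊕ 3 · gap total ⊕ 3 · gap (min-degree x) ⊕ 0≤+ {2})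
            (certificate (size Y) d (∑ₗ (λ y → ⟦ adj y x ⟧) ys) (∑ₗ (λ y → ⟦ adj y x ⟧ * degIn Y y) ys) (deg x))
            where
            certificate : ∀ Y d a w e →
              (1ℤ + (Y - d)) * (a - (1ℤ + + 2)) + (+ 3 * w - (1ℤ + (Y - d)) * a) + + 3 * (Y - (w + e)) + + 3 * (e - d) + + 2 ≡ - 1ℤ
            certificate = solve-∀
            weights : ∀ ys → All (λ y → high y ≡ true) ys →
              (1ℤ + (size Y - d)) * ∑ₗ (λ y → ⟦ adj y x ⟧) ys ≤ + 3 * ∑ₗ (λ y → ⟦ adj y x ⟧ * degIn Y y) ys
            weights [] [] = ≤-reflexive (*-zeroʳ (1ℤ + (size Y - d)))
            weights (y ∷ ys) (y∈H ∷ ys⊆H) = by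
              (⟦⟧≥0 (adj y x) ⊗ gap< (proj₂ (high⇒ {y} y∈H)) ⊕ gap (weights ys ys⊆H))
              (split ⟦ adj y x ⟧ (size Y - d) (degIn Y y) (∑ₗ (λ y → ⟦ adj y x ⟧) ys) (∑ₗ (λ y → ⟦ adj y x ⟧ * degIn Y y) ys))
              where
              split : ∀ b s e a w → b * (+ 3 * e - (1ℤ + s)) + (+ 3 * w - (1ℤ + s) * a) ≡ + 3 * (b * e + w) - (1ℤ + s) * (b + a)
              split = solve-∀
            term : Fin n → Fin n → ℤ
            term m y = ⟦ adj y x ⟧ * (⟦ adj y m ⟧ * ⟦ Y m ⟧)
            ∑ₗ-zero : ∀ {m} ys → All (λ y → term m y ≡ 0ℤ) ys → ∑ₗ (term m) ys ≡ 0ℤ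
            ∑ₗ-zero [] [] = refl
            ∑ₗ-zero (y ∷ ys) (p ∷ ps) = cong₂ _+_ p (∑ₗ-zero ys ps)
            at-most-one : ∀ m ys → AllPairs (λ c y → ¬ Meet c y) ys → ∑ₗ (term m) ys ≤ ⟦ Y m ⟧
            at-most-one m [] [] = ⟦⟧≥0 (Y m)
            at-most-one m (y ∷ ys) (apart ∷ pairs) with Y m in m∈Y | adj y m in ym
            ... | false | a = ≤-reflexive (trans (cong (_+_ (⟦ adj y x ⟧ * (⟦ a ⟧ * 0ℤ))) (vanish ys))
                (trans (+-identityʳ _) (trans (cong (⟦ adj y x ⟧ *_) (*-zeroʳ ⟦ a ⟧)) (*-zeroʳ ⟦ adj y x ⟧))))
              where
              vanish : ∀ ys → ∑ₗ (λ y → ⟦ adj y x ⟧ * (⟦ adj y m ⟧ * 0ℤ)) ys ≡ 0ℤ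
              vanish [] = refl
              vanish (y ∷ ys) = cong₂ _+_ (trans (cong (⟦ adj y x ⟧ *_) (*-zeroʳ ⟦ adj y m ⟧)) (*-zeroʳ ⟦ adj y x ⟧)) (vanish ys)
            ... | true | false = subst (λ b → ⟦ adj y x ⟧ * 0ℤ + ∑ₗ (λ y → ⟦ adj y x ⟧ * (⟦ adj y m ⟧ * ⟦ b ⟧)) ys ≤ ⟦ b ⟧) m∈Y
                (≤-trans (≤-reflexive (trans (cong (_+ ∑ₗ (term m) ys) (*-zeroʳ ⟦ adj y x ⟧)) (+-identityˡ _)))
                         (at-most-one m ys pairs))
            ... | true | true = subst (λ b → ⟦ adj y x ⟧ * 1ℤ + ∑ₗ (λ y → ⟦ adj y x ⟧ * (⟦ adj y m ⟧ * ⟦ b ⟧)) ys ≤ 1ℤ) m∈Y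
                (≤-trans (≤-reflexive (trans (cong (_+_ (⟦ adj y x ⟧ * 1ℤ)) (∑ₗ-zero {m} ys (All.map absent apart)))
                            (trans (+-identityʳ _) (*-identityʳ ⟦ adj y x ⟧))))
                         (⟦⟧≤1 (adj y x)))
              where
              absent : ∀ {y′} → ¬ Meet y y′ → term m y′ ≡ 0ℤ
              absent {y′} ¬meet with adj y′ m in y′m
              ... | true  = ⊥-elim (¬meet (m , ym , y′m , m∈Y))
              ... | false = *-zeroʳ ⟦ adj y′ x ⟧
            pointwise : ∀ m → ∑ₗ (term m) ys + ⟦ adj x m ⟧ ≤ ⟦ Y m ⟧
            pointwise m with adj x m in xm
            ... | false = ≤-trans (≤-reflexive (+-identityʳ _)) (at-most-one m ys pairs)
            ... | true  = ≤-reflexive (trans (cong (_+ 1ℤ) (∑ₗ-zero {m} ys (All.universal absent ys)))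
                                             (cong ⟦_⟧ (sym (N[X]⊆Y x∈X xm))))
              where
              absent : ∀ y → term m y ≡ 0ℤ
              absent y with adj y x in yx | adj y m in ym
              ... | true  | true  = ⊥-elim (triangle-free yx xm ym)
              ... | true  | false = refl
              ... | false | a     = refl
            ∑ₗ-swap : ∀ ys → ∑ₗ (λ y → ⟦ adj y x ⟧ * degIn Y y) ys ≡ ∑ (λ m → ∑ₗ (term m) ys)
            ∑ₗ-swap [] = sym (trans (∑-const n 0ℤ) (*-zeroʳ (+ n)))
            ∑ₗ-swap (y ∷ ys) = trans (cong₂ _+_ (sym (∑-*ˡ ⟦ adj y x ⟧ _)) (∑ₗ-swap ys)) (sym (∑-distrib-+ _ _))
            total : ∑ₗ (λ y → ⟦ adj y x ⟧ * degIn Y y) ys + deg x ≤ size Y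
            total = ≤-trans (≤-reflexive (trans (cong (_+ deg x) (∑ₗ-swap ys)) (sym (∑-distrib-+ _ _)))) (∑-mono pointwise)

        dense-colouring : Colouring 7 (λ _ → true)
        -- `X`, `low` and the five colours from `greedy 4` make seven.
        dense-colouring with greedy 4 high (λ _ v∈H → v∈H)
        ... | inj₂ (ys , len , ys⊆H , pairs) = ⊥-elim (no-five-disjoint ys len ys⊆H pairs)
        ... | inj₁ high-colouring = colour-union (λ v _ → X-or-Y v) (colour-independent X-independent)
          (colour-union cover (colour-independent λ {u} {v} → low-independent {u} {v}) high-colouring)
          where
          cover : ∀ v → Y v ≡ true → low v ≡ true ⊎ high v ≡ true
          cover v v∈Y with ∖-cover Y high v v∈Y
          ... | inj₁ v∈H = inj₂ v∈H
          ... | inj₂ v∈L = inj₁ v∈L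

      nearly-bipartite-colouring : Colouring (7 ℕ.+ t) (λ _ → true)
      nearly-bipartite-colouring with size Y ≤? d + + 9 * + f
      ... | yes sparse = Sparse.sparse-colouring sparse
      ... | no  dense  = Colouring-mono (ℕ.m≤m+n 7 t) (Dense.dense-colouring (≰⇒> dense))

  -- Kneser graphs

  nC0≡1 : ∀ n → n C 0 ≡ 1
  nC0≡1 n = trans (nCk≡nC[n∸k] {n = n} z≤n) (nCn≡1 n)

  0<[k+j]Ck : ∀ k j → 0 ℕ.< (k ℕ.+ j) C k
  0<[k+j]Ck zero    j = ℕ.≤-reflexive (sym (nC0≡1 j))
  0<[k+j]Ck (suc k) j = ℕ.≤-trans (0<[k+j]Ck k j)
    (ℕ.≤-trans (ℕ.m≤m+n _ _) (ℕ.≤-reflexive (nCk+nC[k+1]≡[n+1]C[k+1] (k ℕ.+ j) k)))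

  -- The other summand in Pascal's rule is positive, so the coefficient grows with every step in
  -- `j`.
  j<[1+k+j]C[1+k] : ∀ k j → j ℕ.< (suc k ℕ.+ j) C suc k
  j<[1+k+j]C[1+k] k zero    = 0<[k+j]Ck (suc k) 0
  j<[1+k+j]C[1+k] k (suc j) = begin
    suc (suc j)
      ≤⟨ ℕ.+-mono-≤ (0<[k+j]Ck k (suc j)) (j<[1+k+j]C[1+k] k j) ⟩
    (k ℕ.+ suc j) C k ℕ.+ (suc k ℕ.+ j) C suc k
      ≡⟨ cong (λ m → (k ℕ.+ suc j) C k ℕ.+ m C suc k) (sym (ℕ.+-suc k j)) ⟩
    (k ℕ.+ suc j) C k ℕ.+ (k ℕ.+ suc j) C suc k
      ≡⟨ nCk+nC[k+1]≡[n+1]C[k+1] (k ℕ.+ suc j) k ⟩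
    (suc k ℕ.+ suc j) C suc k ∎
    where open ℕ.≤-Reasoning

  -- The hypothesis concerns subgraphs with exactly f vertices, so there must be enough Kneser
  -- vertices to pad a smaller set.
  KG-order-lower : ∀ P f .{{_ : NonZero P}} → f ℕ.≤ (2 ℕ.* P ℕ.+ 21 ℕ.* f) C P
  KG-order-lower (suc p) f = begin
    f
      ≤⟨ ℕ.m≤m+n f (20 ℕ.* f) ⟩
    21 ℕ.* f
      ≤⟨ ℕ.m≤n+m (21 ℕ.* f) (suc p) ⟩
    suc p ℕ.+ 21 ℕ.* f
      ≤⟨ ℕ.<⇒≤ (j<[1+k+j]C[1+k] p (suc p ℕ.+ 21 ℕ.* f)) ⟩
    (suc p ℕ.+ (suc p ℕ.+ 21 ℕ.* f)) C suc p
      ≡⟨ cong (_C suc p) (trans (sym (ℕ.+-assoc (suc p) (suc p) (21 ℕ.* f)))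
           (cong (λ m → suc p ℕ.+ m ℕ.+ 21 ℕ.* f) (sym (ℕ.+-identityʳ (suc p))))) ⟩
    (2 ℕ.* suc p ℕ.+ 21 ℕ.* f) C suc p ∎
    where open ℕ.≤-Reasoning

  opaque
    unfolding ∑

    ∑-indicator : ∀ {n} (i : Fin n) → size (λ j → does (i Fin.≟ j)) ≡ 1ℤ
    ∑-indicator {suc n} zero = cong (_+_ 1ℤ) (trans (∑-const n 0ℤ) (*-zeroʳ (+ n)))
    ∑-indicator (suc i) = trans (+-identityˡ _) (∑-indicator i)

    listing : ∀ {n} (S : Fin n → Bool) k → size S ≡ + k →
      Σ[ e ∈ (Fin k → Fin n) ] Injective _≡_ _≡_ e × (∀ i → S i ≡ true → ∃[ j ] e j ≡ i)
    listing {zero} S zero _ = (λ ()) , (λ { {()} }) , λ ()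
    listing {suc n} S k |S| with S zero in S0
    ... | false with e , inj , sur ← listing (S ∘ suc) k (trans (sym (+-identityˡ _)) |S|) =
        suc ∘ e , inj ∘ Fin.suc-injective ,
        λ { zero S0′ → case trans (sym S0) S0′ of λ () ; (suc i) Si → let j , eq = sur i Si in j , cong suc eq }
    listing {suc n} S zero |S| | true =
      ⊥-elim (<⇒≱ (+<+ z<s) (≤-trans (+-monoʳ-≤ 1ℤ (size≥0 (S ∘ suc))) (≤-reflexive |S|)))
    listing {suc n} S (suc k) |S| | true
      with e , inj , sur ← listing (S ∘ suc) k (trans (sym (pred-suc _)) (trans (cong ℤ.pred |S|) (pred-suc (+ k)))) =
        e′ , inj′ , sur′
      where
      e′ : Fin (suc k) → Fin (suc n)
      e′ zero    = zero
      e′ (suc j) = suc (e j)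
      inj′ : Injective _≡_ _≡_ e′
      inj′ {zero}  {zero}  _  = refl
      inj′ {suc i} {suc j} eq = cong suc (inj (Fin.suc-injective eq))
      sur′ : ∀ i → S i ≡ true → ∃[ j ] e′ j ≡ i
      sur′ zero    _  = zero , refl
      sur′ (suc i) Si = let j , eq = sur i Si in suc j , cong suc eq

    -- Numbers the elements of `X` in increasing order and transports `T` along this numbering;
    -- positions beyond the last element of `X` stay outside. Subsets of `X` thus become subsets of
    -- the Kneser ground set.
    compress : ∀ {n} (X : Fin n → Bool) N → (Fin n → Bool) → Subset N
    compress {zero}  X N       T = Subset.⊥
    compress {suc n} X N       T with X zero
    compress {suc n} X N       T | false = compress (X ∘ suc) N (T ∘ suc)
    -- A default value, excluded when `size X ≤ + N`.
    compress {suc n} X zero    T | true  = []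
    compress {suc n} X (suc N) T | true  = T zero ∷ compress (X ∘ suc) N (T ∘ suc)

    ∣compress∣ : ∀ {n} (X : Fin n → Bool) N T → size X ≤ + N → (∀ i → T i ≡ true → X i ≡ true) →
      + ∣ compress X N T ∣ ≡ size T
    ∣compress∣ {zero}  X N T X≤N _ = cong +_ (Subset.∣⊥∣≡0 N)
    ∣compress∣ {suc n} X N T X≤N T⊆X with X zero in X0
    ... | false = trans (∣compress∣ (X ∘ suc) N (T ∘ suc) (≤-trans (≤-reflexive (sym (+-identityˡ (size (X ∘ suc))))) X≤N) (T⊆X ∘ suc))
        (trans (sym (+-identityˡ (size (T ∘ suc))))
          (cong (λ b → ⟦ b ⟧ + size (T ∘ suc)) (sym (¬-not λ T0 → case trans (sym (T⊆X zero T0)) X0 of λ ()))))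
    ∣compress∣ {suc n} X zero T X≤N T⊆X | true =
      ⊥-elim (<⇒≱ (+<+ z<s) (≤-trans (+-monoʳ-≤ 1ℤ (size≥0 (X ∘ suc))) X≤N))
    ∣compress∣ {suc n} X (suc N) T X≤N T⊆X | true =
      trans (∣∷∣ (T zero) (compress (X ∘ suc) N (T ∘ suc)))
        (cong (_+_ ⟦ T zero ⟧) (∣compress∣ (X ∘ suc) N (T ∘ suc)
          (by (gap X≤N) (cancel-suc (+ N) (size (X ∘ suc)))) (T⊆X ∘ suc)))
      where
      ∣∷∣ : ∀ {m} b (s : Subset m) → + ∣ b ∷ s ∣ ≡ ⟦ b ⟧ + + ∣ s ∣
      ∣∷∣ true  s = refl
      ∣∷∣ false s = refl

    compress-disjoint : ∀ {n} (X : Fin n → Bool) N T U →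
      (∀ i → T i ≡ true → U i ≡ true → ⊥) → Empty (compress X N T ∩ compress X N U)
    compress-disjoint {zero}  X N T U _ (i , i∈) = Subset.∉⊥ (proj₁ (Subset.x∈p∩q⁻ Subset.⊥ Subset.⊥ i∈))
    compress-disjoint {suc n} X N T U disjoint i∈ with X zero
    compress-disjoint {suc n} X N T U disjoint i∈ | false =
      compress-disjoint (X ∘ suc) N (T ∘ suc) (U ∘ suc) (disjoint ∘ suc) i∈
    compress-disjoint {suc n} X zero T U disjoint (() , _) | true
    compress-disjoint {suc n} X (suc N) T U disjoint (zero , i∈) | true
      with T zero in T0 | U zero in U0
    ... | true  | true = disjoint zero T0 U0
    compress-disjoint {suc n} X (suc N) T U disjoint (zero , ()) | true | true  | false
    compress-disjoint {suc n} X (suc N) T U disjoint (zero , ()) | true | false | _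
    compress-disjoint {suc n} X (suc N) T U disjoint (suc i , there i∈) | true =
      compress-disjoint (X ∘ suc) N (T ∘ suc) (U ∘ suc) (disjoint ∘ suc) (i , i∈)

  -- The indicator of the image is at most the sum of the indicators of the points `h y` over `y` in
  -- `R`.
  image-size : ∀ {m n} (R : Fin m → Bool) (h : Fin m → Fin n) →
    size (λ j → does (any? λ y → (R y Bool.≟ true) ×-dec (h y Fin.≟ j))) ≤ size R
  image-size R h = begin
    ∑ (λ j → ⟦ does (any? λ y → (R y Bool.≟ true) ×-dec (h y Fin.≟ j)) ⟧)
      ≤⟨ ∑-mono pointwise ⟩
    ∑ (λ j → ∑ λ y → ⟦ R y ⟧ * ⟦ does (h y Fin.≟ j) ⟧)
      ≡⟨ ∑-comm _ ⟩
    ∑ (λ y → ∑ λ j → ⟦ R y ⟧ * ⟦ does (h y Fin.≟ j) ⟧)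
      ≡⟨ ∑-cong (λ y → trans (∑-*ˡ ⟦ R y ⟧ _) (trans (cong (⟦ R y ⟧ *_) (∑-indicator (h y))) (*-identityʳ ⟦ R y ⟧))) ⟩
    size R ∎
    where
    open ≤-Reasoning
    single : ∀ {n} (f : Fin n → ℤ) → (∀ i → 0ℤ ≤ f i) → ∀ i → f i ≤ ∑ f
    single {n} f f≥0 i = begin
      f i                                        ≡⟨ *-identityˡ (f i) ⟨
      1ℤ * f i                                   ≡⟨ cong (_* f i) (∑-indicator i) ⟨
      ∑ (λ j → ⟦ does (i Fin.≟ j) ⟧) * f i       ≡⟨ ∑-*ʳ (f i) _ ⟨
      ∑ (λ j → ⟦ does (i Fin.≟ j) ⟧ * f i)       ≤⟨ ∑-mono select ⟩
      ∑ f ∎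
      where
      select : ∀ j → ⟦ does (i Fin.≟ j) ⟧ * f i ≤ f j
      select j with i Fin.≟ j
      ... | yes refl = ≤-reflexive (*-identityˡ (f i))
      ... | no _     = ≤-trans (≤-reflexive (*-zeroˡ (f i))) (f≥0 j)
    pointwise : ∀ j → ⟦ does (any? λ y → (R y Bool.≟ true) ×-dec (h y Fin.≟ j)) ⟧ ≤
      ∑ λ y → ⟦ R y ⟧ * ⟦ does (h y Fin.≟ j) ⟧
    pointwise j with any? (λ y → (R y Bool.≟ true) ×-dec (h y Fin.≟ j))
    ... | no _ = ∑-nonneg λ y → ⟦⟧≥0 (R y) ⊗ ⟦⟧≥0 (does (h y Fin.≟ j))
    ... | yes (y , y∈R , hy≡j) = ≤-trans
      (≤-reflexive (sym (cong₂ (λ a b → ⟦ a ⟧ * ⟦ b ⟧) y∈R (dec-true (h y Fin.≟ j) hy≡j))))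
      (single (λ y → ⟦ R y ⟧ * ⟦ does (h y Fin.≟ j) ⟧) (λ y → ⟦⟧≥0 (R y) ⊗ ⟦⟧≥0 (does (h y Fin.≟ j))) y)

  -- The missing elements are taken from the complement by `subsetOfSize`.
  enlarge : ∀ {n} (S : Fin n → Bool) k → size S ≤ + k → k ℕ.≤ n →
    ∃[ T ] (∀ i → S i ≡ true → T i ≡ true) × size {n} T ≡ + k
  enlarge {n} S k S≤k k≤n = (λ i → S i ∨ proj₁ extra i) , S⊆ , size-union
    where
    size-∁ : size S + size (not ∘ S) ≡ + n
    size-∁ = trans (sym (∑-distrib-+ _ _)) (trans (∑-cong λ i → pointwise (S i))
      (trans (∑-const n 1ℤ) (*-identityʳ (+ n))))
      where
      pointwise : ∀ b → ⟦ b ⟧ + ⟦ not b ⟧ ≡ 1ℤ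
      pointwise true  = refl
      pointwise false = refl
    missing : Σ[ m ∈ ℕ ] + m ≡ + k - size S
    missing with + k - size S | gap S≤k
    ... | + m | _ = m , refl
    extra : ∃[ T ] (∀ i → T i ≡ true → not (S i) ≡ true) × size {n} T ≡ + proj₁ missing
    extra = subsetOfSize (not ∘ S) (proj₁ missing) (by (gap (+≤+ k≤n))
      (trans (cong (_- + k) (sym size-∁)) (trans (rearrange (size S) (size (not ∘ S)) (+ k))
        (cong (_-_ (size (not ∘ S))) (sym (proj₂ missing))))))
      where
      rearrange : ∀ s c k → s + c - k ≡ c - (k - s)
      rearrange = solve-∀
    S⊆ : ∀ i → S i ≡ true → S i ∨ proj₁ extra i ≡ true
    S⊆ i Si rewrite Si = refl
    size-union : size (λ i → S i ∨ proj₁ extra i) ≡ + k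
    size-union = trans (∑-cong pointwise) (trans (∑-distrib-+ _ _)
      (trans (cong (_+_ (size S)) (trans (proj₂ (proj₂ extra)) (proj₂ missing))) (cancel (size S) (+ k))))
      where
      cancel : ∀ s k → s + (k - s) ≡ k
      cancel = solve-∀
      pointwise : ∀ i → ⟦ S i ∨ proj₁ extra i ⟧ ≡ ⟦ S i ⟧ + ⟦ proj₁ extra i ⟧
      pointwise i with S i in Si | proj₁ extra i in Ti
      ... | false | b     = sym (+-identityˡ ⟦ b ⟧)
      ... | true  | false = refl
      ... | true  | true  = case trans (sym (cong not Si)) (proj₁ (proj₂ extra) i Ti) of λ ()

  -- Pulling a colouring back from a Kneser graph

  module KneserColouring {n : ℕ} (adj : Fin n → Fin n → Bool)
    (adj-sym : ∀ {u v} → adj u v ≡ true → adj v u ≡ true)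
    (triangle-free : ∀ {u v w} → adj u v ≡ true → adj v w ≡ true → adj u w ≡ true → ⊥)
    (P f t : ℕ) .{{P≢0 : NonZero P}} (f>0 : 1 ℕ.≤ f) (t>0 : 1 ℕ.≤ t)
    (subgraphs : ∀ (H : Graph) → Graph.order H ≡ f → H IsSubgraphOf KG P (21 ℕ.* f) → Colorable t H)
    (X R : Fin n → Bool) (X-small : size X ≤ + 2 * + P + + 21 * + f)
    where
    open TriangleFree adj adj-sym triangle-free
    open LargeDegree adj adj-sym triangle-free

    N : ℕ
    N = 2 ℕ.* P ℕ.+ 21 ℕ.* f

    X≤N : size X ≤ + N
    X≤N = ≤-trans X-small (≤-reflexive (cong₂ _+_ (sym (pos-* 2 P)) (sym (pos-* 21 f))))

    f≤NCP : f ℕ.≤ N C P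
    f≤NCP = KG-order-lower P f

    opaque
      encode : SubsetOfSize N P → Fin (N C P)
      encode = Inverse.to (subsetsOfSize-↔ N P)

      decode : Fin (N C P) → SubsetOfSize N P
      decode = Inverse.from (subsetsOfSize-↔ N P)

      encode∘decode : ∀ i → encode (decode i) ≡ i
      encode∘decode = Inverse.strictlyInverseˡ (subsetsOfSize-↔ N P)

      decode∘encode : ∀ s → decode (encode s) ≡ s
      decode∘encode = Inverse.strictlyInverseʳ (subsetsOfSize-↔ N P)

    module _ (many-neighbours : ∀ y → R y ≡ true → + P ≤ degIn X y) (R-small : size R ≤ + f) where

      trace : ∀ y → R y ≡ true → ∃[ T ] (∀ i → T i ≡ true → adj y i ∧ X i ≡ true) × size {n} T ≡ + P
      trace y y∈R = subsetOfSize (λ i → adj y i ∧ X i) P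
        (≤-trans (many-neighbours y y∈R) (≤-reflexive (∑-cong λ i → pointwise (adj y i) (X i))))
        where
        pointwise : ∀ a b → ⟦ a ⟧ * ⟦ b ⟧ ≡ ⟦ a ∧ b ⟧
        pointwise true  b = *-identityˡ ⟦ b ⟧
        pointwise false b = *-zeroˡ ⟦ b ⟧

      kneserVertex : ∀ y → R y ≡ true → SubsetOfSize N P
      kneserVertex y y∈R = let T , T⊆ , |T| = trace y y∈R in
        compress X N T ,
        +-injective (trans (∣compress∣ X N T X≤N (λ i i∈T → proj₂ (∧-true {adj y i} (T⊆ i i∈T)))) |T|)

      -- Passing the value of `R y` together with its equation hands `kneserVertex` the membership
      -- proof it needs. Outside `R` the value is a default that `used` ignores.
      code′ : ∀ y b → R y ≡ b → Fin (N C P)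
      code′ y true  y∈R = encode (kneserVertex y y∈R)
      code′ y false _   = Fin.fromℕ< (ℕ.≤-trans f>0 f≤NCP)

      code : Fin n → Fin (N C P)
      code y = code′ y (R y) refl

      used : Fin (N C P) → Bool
      used j = does (any? λ y → (R y Bool.≟ true) ×-dec (code y Fin.≟ j))

      -- Vertices of `R` may share a code and `R` may be smaller than f, so the used Kneser vertices
      -- are padded to exactly f.
      chosen : ∃[ J ] (∀ j → used j ≡ true → J j ≡ true) × size {N C P} J ≡ + f
      chosen = enlarge used f (≤-trans (image-size R code) R-small) f≤NCP

      chosen-listing = listing (proj₁ chosen) f (proj₂ (proj₂ chosen))

      vertex : Fin f → SubsetOfSize N P
      vertex i = decode (proj₁ chosen-listing i)

      -- The subgraph of the Kneser graph induced on the chosen vertices.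
      H : Graph
      H = record
        { Vertex     = Fin f
        ; Adj        = λ i j → Graph.Adj (KG P (21 ℕ.* f)) (vertex i) (vertex j)
        ; Adj-irrefl = λ {i} {j} eq → Graph.Adj-irrefl (KG P (21 ℕ.* f)) {vertex i} {vertex j} (cong vertex eq)
        ; Adj-sym    = λ {i} {j} → Graph.Adj-sym (KG P (21 ℕ.* f)) {vertex i} {vertex j}
        ; Adj?       = λ i j → Graph.Adj? (KG P (21 ℕ.* f)) (vertex i) (vertex j)
        ; order      = f
        ; enumerate  = ↔-id (Fin f)
        }

      H⊆KG : H IsSubgraphOf KG P (21 ℕ.* f)
      H⊆KG = record
        { embed     = vertex
        ; injective = λ {i} {j} eq → proj₁ (proj₂ chosen-listing)
            (trans (sym (encode∘decode _)) (trans (cong encode eq) (encode∘decode _)))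
        ; preserves = λ p → p
        }

      H-colouring : Colorable t H
      H-colouring = subgraphs H refl H⊆KG

      index : ∀ y → R y ≡ true → ∃[ i ] proj₁ chosen-listing i ≡ code y
      index y y∈R = proj₂ (proj₂ chosen-listing) (code y) (proj₁ (proj₂ chosen) (code y)
        (dec-true (any? λ y′ → (R y′ Bool.≟ true) ×-dec (code y′ Fin.≟ code y)) (y , y∈R , refl)))

      -- Abstracting the value of `R y` lets `code′` reduce. The vertex is then built from the
      -- membership proof found there, hence the existential.
      index-vertex : ∀ y (y∈R : R y ≡ true) → ∃[ y∈R′ ] vertex (proj₁ (index y y∈R)) ≡ kneserVertex y y∈R′
      index-vertex y y∈R = lemma (R y) refl y∈R (cong decode (proj₂ (index y y∈R)))
        where
        lemma : ∀ b (eq : R y ≡ b) → R y ≡ true → ∀ {v} → v ≡ decode (code′ y b eq) → ∃[ y∈R′ ] v ≡ kneserVertex y y∈R′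
        lemma true  eq _   p = eq , trans p (decode∘encode (kneserVertex y eq))
        lemma false eq y∈R _ = case trans (sym y∈R) eq of λ ()

      -- A point in both traces would be a common neighbour of `u` and `v`. Thus adjacency in `R` is
      -- preserved, and colours can be pulled back even where two vertices share a Kneser vertex.
      vertices-adjacent : ∀ {u v} (u∈R : R u ≡ true) (v∈R : R v ≡ true) → adj u v ≡ true →
        Graph.Adj (KG P (21 ℕ.* f)) (kneserVertex u u∈R) (kneserVertex v v∈R)
      vertices-adjacent {u} {v} u∈R v∈R uv = compress-disjoint X N (proj₁ (trace u u∈R)) (proj₁ (trace v v∈R))
        λ i i∈u i∈v → triangle-free uv (proj₁ (∧-true (proj₁ (proj₂ (trace v v∈R)) i i∈v)))
                                       (proj₁ (∧-true (proj₁ (proj₂ (trace u u∈R)) i i∈u)))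

      colour′ : ∀ y b → R y ≡ b → Fin t
      colour′ y true  y∈R = proj₁ H-colouring (proj₁ (index y y∈R))
      colour′ y false _   = Fin.fromℕ< t>0

      kneser-colouring : Colouring t R
      kneser-colouring = (λ y → colour′ y (R y) refl) , λ {u} {v} → proper (R u) (R v) refl refl
        where
        proper : ∀ {u v} b c (u∈R : R u ≡ b) (v∈R : R v ≡ c) → R u ≡ true → R v ≡ true → adj u v ≡ true →
          colour′ u b u∈R ≢ colour′ v c v∈R
        proper {u} {v} true true u∈R v∈R _ _ uv =
          let u∈R′ , u≡ = index-vertex u u∈R
              v∈R′ , v≡ = index-vertex v v∈R
          in proj₂ H-colouring {proj₁ (index u u∈R)} {proj₁ (index v v∈R)}
               (subst₂ (Graph.Adj (KG P (21 ℕ.* f))) (sym u≡) (sym v≡) (vertices-adjacent u∈R′ v∈R′ uv))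
        proper true  false _ v∈R _ v∈R′ _ = case trans (sym v∈R) v∈R′ of λ ()
        proper false _     u∈R _ u∈R′ _ _ = case trans (sym u∈R) u∈R′ of λ ()

-- The rational hypotheses as integer inequalities

module Reduction where
  open import Data.Integer using (_≤_; _<_; _<?_)
  open import Data.Integer.Properties
  open import Data.Rational using (_/_; _-_; ceiling)
  open Development

  -- The fraction `mkℚᵘ a 2` is a/3; this form exposes an integer numerator to the rounding below.
  third-minus : ∀ n m → toℚᵘ (+ n / 3 - fromℕ m) ℚᵘ.≃ mkℚᵘ (+ n ℤ.- + 3 ℤ.* + m) 2
  third-minus n m = begin
    toℚᵘ (+ n / 3 - fromℕ m)
      ≈⟨ ℚ.toℚᵘ-homo-+ (+ n / 3) (ℚ.- fromℕ m) ⟩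
    toℚᵘ (+ n / 3) ℚᵘ.+ toℚᵘ (ℚ.- fromℕ m)
      ≈⟨ ℚᵘ.+-cong (ℚ.toℚᵘ-fromℚᵘ (mkℚᵘ (+ n) 2))
           (ℚᵘ.≃-trans (ℚ.toℚᵘ-homo‿- (fromℕ m)) (ℚᵘ.-‿cong (ℚ.toℚᵘ-fromℚᵘ (mkℚᵘ (+ m) 0)))) ⟩
    mkℚᵘ (+ n) 2 ℚᵘ.- mkℚᵘ (+ m) 0
      ≈⟨ ℚᵘ.*≡* (cross (+ n) (+ m)) ⟩
    mkℚᵘ (+ n ℤ.- + 3 ℤ.* + m) 2 ∎
    where
    open ℚᵘ.≃-Reasoning
    cross : ∀ n m → (n ℤ.* 1ℤ ℤ.+ ℤ.- m ℤ.* + 3) ℤ.* + 3 ≡ (n ℤ.- + 3 ℤ.* m) ℤ.* + 3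
    cross = solve-∀

  min-degree-bound : ∀ n m e → + n / 3 - fromℕ m ℚ.≤ fromℕ e → + n ≤ + 3 ℤ.* + e ℤ.+ + 3 ℤ.* + m
  min-degree-bound n m e p = by (gap (ℚᵘ.drop-*≤* scaled)) (certificate (+ n) (+ m) (+ e))
    where
    scaled : mkℚᵘ (+ n ℤ.- + 3 ℤ.* + m) 2 ℚᵘ.≤ mkℚᵘ (+ e) 0
    scaled = ℚᵘ.≤-respˡ-≃ (third-minus n m)
      (ℚᵘ.≤-respʳ-≃ (ℚ.toℚᵘ-fromℚᵘ (mkℚᵘ (+ e) 0)) (ℚ.toℚᵘ-mono-≤ p))
    certificate : ∀ n m e → e ℤ.* + 3 ℤ.- (n ℤ.- + 3 ℤ.* m) ℤ.* 1ℤ ≡ + 3 ℤ.* e ℤ.+ + 3 ℤ.* m ℤ.- n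
    certificate = solve-∀

  -- With `q = a/3`, the numerator of `- q` over `D` is `r + m D`, and `- m` is the ceiling of `q`.
  -- The difference `3 (- m) D - a D` is `3 r`, which lies in [0, 3D).
  rounding-bounds : ∀ m r D a .{{_ : ℤ.Positive D}} → + r < D → ℤ.- (+ 3 ℤ.* (+ r ℤ.+ m ℤ.* D)) ≡ a ℤ.* D →
    a ≤ + 3 ℤ.* (ℤ.- m) × + 3 ℤ.* (ℤ.- m) ≤ a ℤ.+ + 2
  rounding-bounds m r D a r<D aD =
    *-cancelʳ-≤-pos a (+ 3 ℤ.* (ℤ.- m)) D
      (by (3 · 0≤+ {r}) (trans (lower (+ r) m D) (cong (λ z → + 3 ℤ.* (ℤ.- m) ℤ.* D ℤ.- z) aD))) ,
    ≮⇒≥ (λ gt → absurdBy (<⇒≤ (positive⁻¹ D) ⊗ gap< gt ⊕ 3 · gap< r<D ⊕ 0≤+ {2})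
      (trans (upper a (+ r) m D) (trans (cong (λ z → z ℤ.- a ℤ.* D ℤ.- 1ℤ) aD) (cong (ℤ._- 1ℤ) (+-inverseʳ (a ℤ.* D))))))
    where
    lower : ∀ r m D → + 3 ℤ.* r ≡ + 3 ℤ.* (ℤ.- m) ℤ.* D ℤ.- (ℤ.- (+ 3 ℤ.* (r ℤ.+ m ℤ.* D)))
    lower = solve-∀
    upper : ∀ a r m D →
      D ℤ.* (+ 3 ℤ.* (ℤ.- m) ℤ.- (1ℤ ℤ.+ (a ℤ.+ + 2))) ℤ.+ + 3 ℤ.* (D ℤ.- (1ℤ ℤ.+ r)) ℤ.+ + 2 ≡
      ℤ.- (+ 3 ℤ.* (r ℤ.+ m ℤ.* D)) ℤ.- a ℤ.* D ℤ.- 1ℤ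
    upper = solve-∀

  ceiling-bounds : ∀ q a → toℚᵘ q ℚᵘ.≃ mkℚᵘ a 2 →
    a ≤ + 3 ℤ.* ceiling q × + 3 ℤ.* ceiling q ≤ a ℤ.+ + 2
  ceiling-bounds q@record{} a eq =
    subst (λ m → a ≤ + 3 ℤ.* (ℤ.- m) × + 3 ℤ.* (ℤ.- m) ≤ a ℤ.+ + 2) (sym (floor-def (ℚ.- q)))
      (rounding-bounds (x ℤ./ D) (x ℤ.% D) D a r<D aD)
    where
    x D : ℤ
    x = ↥ (ℚ.- q)
    D = ↧ (ℚ.- q)
    floor-def : ∀ p → ℚ.floor p ≡ ↥ p ℤ./ ↧ p
    floor-def record{} = refl
    r<D : + (x ℤ.% D) < D
    r<D = +<+ (n%d<d x D)
    signs : ∀ y → ℤ.- (+ 3 ℤ.* ℤ.- y) ≡ y ℤ.* + 3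
    signs = solve-∀
    aD : ℤ.- (+ 3 ℤ.* (+ (x ℤ.% D) ℤ.+ (x ℤ./ D) ℤ.* D)) ≡ a ℤ.* D
    aD = trans (cong (λ z → ℤ.- (+ 3 ℤ.* z)) (sym (a≡a%n+[a/n]*n x D)))
      (trans (cong (λ z → ℤ.- (+ 3 ℤ.* z)) (ℚ.↥-neg q))
        (trans (signs (↥ q)) (trans (ℚᵘ.drop-*≡* eq) (cong (a ℤ.*_) (sym (ℚ.↧-neg q))))))

  kneser-parameter : ∀ n m P → + P ≡ ceiling (+ n / 3 - fromℕ m) →
    + n ≤ + 3 ℤ.* + P ℤ.+ + 3 ℤ.* + m × + 3 ℤ.* + P ℤ.+ + 3 ℤ.* + m ≤ + n ℤ.+ + 2
  kneser-parameter n m P eq with lo , hi ← ceiling-bounds (+ n / 3 - fromℕ m) (+ n ℤ.- + 3 ℤ.* + m) (third-minus n m) =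
    by (gap (subst (λ c → + n ℤ.- + 3 ℤ.* + m ≤ + 3 ℤ.* c) (sym eq) lo)) (lower (+ n) (+ m) (+ P)) ,
    by (gap (subst (λ c → + 3 ℤ.* c ≤ + n ℤ.- + 3 ℤ.* + m ℤ.+ + 2) (sym eq) hi)) (upper (+ n) (+ m) (+ P))
    where
    lower : ∀ n m P → + 3 ℤ.* P ℤ.- (n ℤ.- + 3 ℤ.* m) ≡ + 3 ℤ.* P ℤ.+ + 3 ℤ.* m ℤ.- n
    lower = solve-∀
    upper : ∀ n m P → n ℤ.- + 3 ℤ.* m ℤ.+ + 2 ℤ.- + 3 ℤ.* P ≡ n ℤ.+ + 2 ℤ.- (+ 3 ℤ.* P ℤ.+ + 3 ℤ.* m)
    upper = solve-∀

  little-o-bound : ∀ k m n → fromℕ m ℚ.≤ + 1 / suc k ℚ.* fromℕ n → + suc k ℤ.* + m ≤ + n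
  little-o-bound k m n p = by (gap (ℚᵘ.drop-*≤* scaled)) (certificate (+ suc k) (+ m) (+ n))
    where
    product : mkℚᵘ (+ 1) k ℚᵘ.* mkℚᵘ (+ n) 0 ℚᵘ.≃ mkℚᵘ (+ n) k
    product = ℚᵘ.*≡* (cong₂ ℤ._*_ (*-identityˡ (+ n)) (cong (+_ ∘ suc) (sym (ℕ.*-identityʳ k))))
    scaled : mkℚᵘ (+ m) 0 ℚᵘ.≤ mkℚᵘ (+ n) k
    scaled = ℚᵘ.≤-respˡ-≃ (ℚ.toℚᵘ-fromℚᵘ (mkℚᵘ (+ m) 0)) (ℚᵘ.≤-respʳ-≃
      (ℚᵘ.≃-trans (ℚ.toℚᵘ-homo-* (+ 1 / suc k) (fromℕ n))
        (ℚᵘ.≃-trans (ℚᵘ.*-cong (ℚ.toℚᵘ-fromℚᵘ (mkℚᵘ (+ 1) k)) (ℚ.toℚᵘ-fromℚᵘ (mkℚᵘ (+ n) 0))) product))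
      (ℚ.toℚᵘ-mono-≤ p))
    certificate : ∀ K m n → n ℤ.* 1ℤ ℤ.- m ℤ.* K ≡ n ℤ.- K ℤ.* m
    certificate = solve-∀

  opaque
    unfolding ∑

    length-filter-tabulate : ∀ {n} {A : Set} {Q : A → Set} (Q? : Decidable Q) (h : Fin n → A) →
      + length (filter Q? (tabulate h)) ≡ size (λ i → does (Q? (h i)))
    length-filter-tabulate {zero}  Q? h = refl
    length-filter-tabulate {suc n} Q? h with does (Q? (h zero))
    ... | true  = cong (ℤ._+_ 1ℤ) (length-filter-tabulate Q? (h ∘ suc))
    ... | false = trans (length-filter-tabulate Q? (h ∘ suc)) (sym (+-identityˡ _))

  -- Instantiated with K = 1000, H = 2500, B = 20000 and k = 90.
  core-colouring : ∀ {n} (adj : Fin n → Fin n → Bool)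
    (adj-sym : ∀ {u v} → adj u v ≡ true → adj v u ≡ true)
    (triangle-free : ∀ {u v w} → adj u v ≡ true → adj v w ≡ true → adj u w ≡ true → ⊥)
    (P f t : ℕ) .{{_ : NonZero P}} → 1 ℕ.≤ f → 1 ℕ.≤ t →
    (∀ (H : Graph) → Graph.order H ≡ f → H IsSubgraphOf KG P (21 ℕ.* f) → Colorable t H) →
    (∀ v → + n ≤ + 3 ℤ.* size (adj v) ℤ.+ + 3 ℤ.* + f) →
    + n ≤ + 3 ℤ.* + P ℤ.+ + 3 ℤ.* + (10 ℕ.* f) →
    + 3 ℤ.* + P ℤ.+ + 3 ℤ.* + (10 ℕ.* f) ≤ + n ℤ.+ + 2 →
    (K H : ℤ) → + 952 ≤ K → 0ℤ < H → + 10 ℤ.* K ℤ.* + f ≤ + n →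
    (B k colours : ℕ) .{{_ : NonZero B}} → + B ≡ + 8 ℤ.* H → + 904 ℤ.* H < + 975 ℤ.* (H ℤ.- + 2 ℤ.* + suc k) →
    + 91 ≤ + suc k → B ℕ.^ k ℕ.≤ colours → 7 ℕ.+ t ℕ.≤ colours →
    TriangleFree.Colouring adj adj-sym triangle-free colours (λ _ → true)
  core-colouring {n} adj adj-sym triangle-free P f t f>0 t>0 subgraphs degrees n≤ ≤n K H K≥952 H>0 f≪n B k colours B≡8H H≫k 91≤k B^k≤ 7+t≤ =
    case any? (λ v → + 5 ℤ.* + n ℤ.+ + 30 ℤ.* + f <? + 9 ℤ.* size (adj v)) of λ
      { (yes (z , large)) → Colouring-mono 7+t≤
          (NearlyBipartite.nearly-bipartite-colouring P f t z min-degree n≤3d P≥42f large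
            (KneserColouring.kneser-colouring adj adj-sym triangle-free P f t f>0 t>0 subgraphs))
      ; (no none) → Colouring-mono B^k≤
          (BoundedDegree.bounded-degree-colouring d f d>0
            (λ v → subst (_≤ size (adj v)) (sym +d) (min-degree v))
            (λ v → ≮⇒≥ λ large → none (v , large)) K K≥952 Kn≤ Kf≤d H H>0 B k B≡8H H≫k 91≤k)
      }
    where
    open TriangleFree adj adj-sym triangle-free
    open LargeDegree adj adj-sym triangle-free
    d : ℕ
    d = P ℕ.+ 9 ℕ.* f
    +d : + d ≡ + P ℤ.+ + 9 ℤ.* + f
    +d = trans (pos-+ P (9 ℕ.* f)) (cong (ℤ._+_ (+ P)) (pos-* 9 f))
    K≥0 : 0ℤ ≤ K
    K≥0 = ≤-trans 0≤+ K≥952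
    n≤3d : + n ≤ + 3 ℤ.* (+ P ℤ.+ + 10 ℤ.* + f)
    n≤3d = ≤-trans n≤ (≤-reflexive (trans (cong (λ z → + 3 ℤ.* + P ℤ.+ + 3 ℤ.* z) (pos-* 10 f)) (factor (+ P) (+ f))))
      where
      factor : ∀ P f → + 3 ℤ.* P ℤ.+ + 3 ℤ.* (+ 10 ℤ.* f) ≡ + 3 ℤ.* (P ℤ.+ + 10 ℤ.* f)
      factor = solve-∀
    -- The degree hypothesis and the ceiling give `3 deg ≥ 3P + 27f - 2`, where the 2 is lost in
    -- rounding; integrality recovers it.
    min-degree : ∀ v → + P ℤ.+ + 9 ℤ.* + f ≤ size (adj v)
    min-degree v = ≮⇒≥ λ gt → absurdBy (gap (degrees v) ⊕ gap ≤n ⊕ 3 · gap< gt)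
      (trans (cong (λ z → + 3 ℤ.* size (adj v) ℤ.+ + 3 ℤ.* + f ℤ.- + n ℤ.+ (+ n ℤ.+ + 2 ℤ.- (+ 3 ℤ.* + P ℤ.+ + 3 ℤ.* z))
                      ℤ.+ + 3 ℤ.* (+ P ℤ.+ + 9 ℤ.* + f ℤ.- (1ℤ ℤ.+ size (adj v)))) (pos-* 10 f))
        (certificate (size (adj v)) (+ n) (+ P) (+ f)))
      where
      certificate : ∀ e n P f → + 3 ℤ.* e ℤ.+ + 3 ℤ.* f ℤ.- n ℤ.+ (n ℤ.+ + 2 ℤ.- (+ 3 ℤ.* P ℤ.+ + 3 ℤ.* (+ 10 ℤ.* f)))
        ℤ.+ + 3 ℤ.* (P ℤ.+ + 9 ℤ.* f ℤ.- (1ℤ ℤ.+ e)) ≡ ℤ.- 1ℤ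
      certificate = solve-∀
    -- `10 K f ≤ n ≤ 3P + 30f`, and K is at least 30.
    3Kf≤P : + 3 ℤ.* K ℤ.* + f ≤ + P
    3Kf≤P = *-cancelˡ-≤-pos _ _ (+ 3) (by (gap f≪n ⊕ gap n≤3d ⊕ (gap K≥952 ⊕ 0≤+ {922}) ⊗ 0≤+ {f})
      (certificate K (+ n) (+ P) (+ f)))
      where
      certificate : ∀ K n P f → n ℤ.- + 10 ℤ.* K ℤ.* f ℤ.+ (+ 3 ℤ.* (P ℤ.+ + 10 ℤ.* f) ℤ.- n) ℤ.+ (K ℤ.- + 952 ℤ.+ + 922) ℤ.* f
        ≡ + 3 ℤ.* P ℤ.- + 3 ℤ.* (+ 3 ℤ.* K ℤ.* f)
      certificate = solve-∀
    P≥42f : + 42 ℤ.* + f ≤ + P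
    P≥42f = ≤-trans (by ((3 · gap K≥952 ⊕ 0≤+ {2814}) ⊗ 0≤+ {f}) (certificate K (+ f))) 3Kf≤P
      where
      certificate : ∀ K f → (+ 3 ℤ.* (K ℤ.- + 952) ℤ.+ + 2814) ℤ.* f ≡ + 3 ℤ.* K ℤ.* f ℤ.- + 42 ℤ.* f
      certificate = solve-∀
    d>0 : 0ℤ < + d
    d>0 = +<+ (ℕ.<-≤-trans (ℕ.>-nonZero⁻¹ P) (ℕ.m≤m+n P (9 ℕ.* f)))
    Kf≤d : K ℤ.* + f ≤ + d
    Kf≤d = ≤-trans (by (2 · (K≥0 ⊗ 0≤+ {f}) ⊕ gap 3Kf≤P ⊕ 9 · 0≤+ {f}) (certificate K (+ f) (+ P))) (≤-reflexive (sym +d))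
      where
      certificate : ∀ K f P → + 2 ℤ.* (K ℤ.* f) ℤ.+ (P ℤ.- + 3 ℤ.* K ℤ.* f) ℤ.+ + 9 ℤ.* f ≡ P ℤ.+ + 9 ℤ.* f ℤ.- K ℤ.* f
      certificate = solve-∀
    -- `n ≤ 3d + 3f`, and `3 K f ≤ P ≤ d`.
    Kn≤ : K ℤ.* + n ≤ (+ 3 ℤ.* K ℤ.+ 1ℤ) ℤ.* + d
    Kn≤ = ≤-trans (by (K≥0 ⊗ gap n≤3d ⊕ gap 3Kf≤P ⊕ 9 · 0≤+ {f}) (certificate K (+ n) (+ P) (+ f)))
      (≤-reflexive (cong ((+ 3 ℤ.* K ℤ.+ 1ℤ) ℤ.*_) (sym +d)))
      where
      certificate : ∀ K n P f → K ℤ.* (+ 3 ℤ.* (P ℤ.+ + 10 ℤ.* f) ℤ.- n) ℤ.+ (P ℤ.- + 3 ℤ.* K ℤ.* f) ℤ.+ + 9 ℤ.* f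
        ≡ (+ 3 ℤ.* K ℤ.+ 1ℤ) ℤ.* (P ℤ.+ + 9 ℤ.* f) ℤ.- K ℤ.* n
      certificate = solve-∀

  -- Graphs as Boolean adjacency matrices

  module FromGraph (G : Graph) (K₃-free : (K 3 -Free) G) where
    open Graph G
    open Inverse enumerate using (to; from; strictlyInverseʳ)

    adj : Fin order → Fin order → Bool
    adj i j = does (Adj? (from i) (from j))

    adj⇒Adj : ∀ {i j} → adj i j ≡ true → Adj (from i) (from j)
    adj⇒Adj {i} {j} eq with Adj? (from i) (from j)
    ... | yes p = p

    adj-sym : ∀ {i j} → adj i j ≡ true → adj j i ≡ true
    adj-sym {i} {j} eq = dec-true (Adj? (from j) (from i)) (Adj-sym (adj⇒Adj eq))

    triangle-free : ∀ {u v w} → adj u v ≡ true → adj v w ≡ true → adj u w ≡ true → ⊥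
    triangle-free {u} {v} {w} uv vw uw = K₃-free record
      { embed = corner ; injective = λ {i} {j} → injective i j ; preserves = λ {i} {j} → preserves i j }
      where
      corner : Fin 3 → Vertex
      corner zero             = from u
      corner (suc zero)       = from v
      corner (suc (suc zero)) = from w
      preserves : ∀ i j → i ≢ j → Adj (corner i) (corner j)
      preserves zero             zero             i≢i = ⊥-elim (i≢i refl)
      preserves zero             (suc zero)       _   = adj⇒Adj uv
      preserves zero             (suc (suc zero)) _   = adj⇒Adj uw
      preserves (suc zero)       zero             _   = Adj-sym (adj⇒Adj uv)
      preserves (suc zero)       (suc zero)       i≢i = ⊥-elim (i≢i refl)
      preserves (suc zero)       (suc (suc zero)) _   = adj⇒Adj vw
      preserves (suc (suc zero)) zero             _   = Adj-sym (adj⇒Adj uw)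
      preserves (suc (suc zero)) (suc zero)       _   = Adj-sym (adj⇒Adj vw)
      preserves (suc (suc zero)) (suc (suc zero)) i≢i = ⊥-elim (i≢i refl)
      injective : ∀ i j → corner i ≡ corner j → i ≡ j
      injective i j eq with i Fin.≟ j
      ... | yes i≡j = i≡j
      ... | no  i≢j = ⊥-elim (Adj-irrefl eq (preserves i j i≢j))

    degree-size : ∀ i → + degree (from i) ≡ size (adj i)
    degree-size i = trans (cong (λ vs → + length (filter (Adj? (from i)) vs)) (map-tabulate (λ j → j) from))
      (length-filter-tabulate (Adj? (from i)) from)

    colourable : ∀ {colours} → TriangleFree.Colouring adj adj-sym triangle-free colours (λ _ → true) → Colorable colours G
    colourable (c , proper) = c ∘ to , λ {u} {v} uv → proper refl refl
      (dec-true (Adj? (from (to u)) (from (to v))) (subst₂ Adj (sym (strictlyInverseʳ u)) (sym (strictlyInverseʳ v)) uv))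

  scale : ∀ {L M} x y → L ≡ M → L ℤ.* x ≤ y → M ℤ.* x ≤ y
  scale x y refl p = p

  graph-colouring : ∀ (G : Graph) → (K 3 -Free) G → ∀ (P f t : ℕ) .{{_ : NonZero P}} → 1 ℕ.≤ f → 1 ℕ.≤ t →
    + P ≡ ceiling (+ Graph.order G / 3 - fromℕ (10 ℕ.* f)) →
    (∀ (H : Graph) → Graph.order H ≡ f → H IsSubgraphOf KG P (21 ℕ.* f) → Colorable t H) →
    MinDegreeAtLeast (+ Graph.order G / 3 - fromℕ f) G →
    (K H : ℤ) → + 952 ≤ K → 0ℤ < H → + 10 ℤ.* K ℤ.* + f ≤ + Graph.order G →
    (B k colours : ℕ) .{{_ : NonZero B}} → + B ≡ + 8 ℤ.* H → + 904 ℤ.* H < + 975 ℤ.* (H ℤ.- + 2 ℤ.* + suc k) →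
    + 91 ≤ + suc k → B ℕ.^ k ℕ.≤ colours → 7 ℕ.+ t ℕ.≤ colours →
    Colorable colours G
  graph-colouring G K₃-free P f t f>0 t>0 P≡ subgraphs min-degree K H K≥952 H>0 f≪n B k colours B≡8H H≫k 91≤k B^k≤ 7+t≤ =
    colourable (core-colouring adj adj-sym triangle-free P f t f>0 t>0 subgraphs degrees
      (proj₁ (kneser-parameter n (10 ℕ.* f) P P≡)) (proj₂ (kneser-parameter n (10 ℕ.* f) P P≡))
      K H K≥952 H>0 f≪n B k colours B≡8H H≫k 91≤k B^k≤ 7+t≤)
    where
    open FromGraph G K₃-free
    n : ℕ
    n = Graph.order G
    degrees : ∀ i → + n ≤ + 3 ℤ.* size (adj i) ℤ.+ + 3 ℤ.* + f
    degrees i = ≤-trans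
      (min-degree-bound n f (Graph.degree G (Inverse.from (Graph.enumerate G) i)) (min-degree (Inverse.from (Graph.enumerate G) i)))
      (≤-reflexive (cong (λ e → + 3 ℤ.* e ℤ.+ + 3 ℤ.* + f) (degree-size i)))

  -- `20000^90 = 2^90 · 10^360` is below `10^388`.
  20000^90≤10^391 : 20000 ℕ.^ 90 ℕ.≤ 10 ℕ.^ 391
  20000^90≤10^391 = ℕ.≤ᵇ⇒≤ (20000 ℕ.^ 90) (10 ℕ.^ 391) _

  7≤10^391 : 7 ℕ.≤ 10 ℕ.^ 391
  7≤10^391 = ℕ.≤ᵇ⇒≤ 7 (10 ℕ.^ 391) _

  ≤⇒≤+ : ∀ {a b} t → a ℕ.≤ b → a ℕ.≤ t ℕ.+ b
  ≤⇒≤+ {b = b} t a≤b = ℕ.≤-trans a≤b (ℕ.m≤n+m b t)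

  ≤⇒+≤+ : ∀ {a b} t → a ℕ.≤ b → a ℕ.+ t ℕ.≤ t ℕ.+ b
  ≤⇒+≤+ {a} t a≤b = ℕ.≤-trans (ℕ.≤-reflexive (ℕ.+-comm a t)) (ℕ.+-monoʳ-≤ t a≤b)

-- The theorem, with the constants fixed

open import Data.Nat using (_+_; _*_; _^_; _≤_)
open import Data.Rational using (_/_; _-_; ceiling)

theorem3p2 : ∀ (f : ℕ → ℕ) → (∀ n → 1 ≤ n → 1 ≤ f n) → IsLittleO-id f →
    ∀ (t : ℕ) → 1 ≤ t →
    ∃[ N ] (∀ (n : ℕ) → N ≤ n →
    ∀ (P : ℕ) → .{{_ : NonZero P}} →
    + P ≡ ceiling (+ n / 3 - fromℕ (10 * f n)) →
    (∀ (H : Graph) → Graph.order H ≡ f n →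
    H IsSubgraphOf KG P (21 * f n) → Colorable t H) →
    ∀ (G : Graph) → Graph.order G ≡ n → (K 3 -Free) G →
    MinDegreeAtLeast (+ n / 3 - fromℕ (f n)) G →
    Colorable (t + 10 ^ 391) G)
-- The successor ensures that n is positive, where `f n` is known to be positive.
theorem3p2 f f>0 f≪n t t>0 = suc (proj₁ small) , at-order
  where
  open Reduction
  small : ∃[ N ] (∀ n → N ≤ n → fromℕ (f n) ℚ.≤ + 1 / 10000 ℚ.* fromℕ n)
  -- This is `1 / (10 K)` for K = 1000.
  small = f≪n (+ 1 / 10000) (toWitness {a? = 0ℚ ℚ.<? + 1 / 10000} _)
  at-order : ∀ (n : ℕ) → suc (proj₁ small) ≤ n → ∀ (P : ℕ) → .{{_ : NonZero P}} →
    + P ≡ ceiling (+ n / 3 - fromℕ (10 * f n)) →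
    (∀ (H : Graph) → Graph.order H ≡ f n → H IsSubgraphOf KG P (21 * f n) → Colorable t H) →
    ∀ (G : Graph) → Graph.order G ≡ n → (K 3 -Free) G → MinDegreeAtLeast (+ n / 3 - fromℕ (f n)) G →
    Colorable (t + 10 ^ 391) G
  at-order n N<n P P≡ subgraphs G refl K₃-free min-degree =
    graph-colouring G K₃-free P (f n) t (f>0 n (ℕ.≤-trans (s≤s z≤n) N<n)) t>0 P≡ subgraphs min-degree
      (+ 1000) (+ 2500) (+≤+ (ℕ.≤ᵇ⇒≤ 952 1000 _)) (+<+ z<s)
      (scale {+ 10000} {+ 10 ℤ.* + 1000} (+ f n) (+ n) refl
        (little-o-bound 9999 (f n) n (proj₂ small n (ℕ.≤-trans (ℕ.n≤1+n (proj₁ small)) N<n))))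
      20000 90 (t + 10 ^ 391) refl
      -- 904 · 2500 = 2260000 is just below 975 · (2500 - 182) = 2260050.
      (toWitness {a? = + 904 ℤ.* + 2500 ℤ.<? + 975 ℤ.* (+ 2500 ℤ.- + 2 ℤ.* + 91)} _) ℤ.≤-refl
      (≤⇒≤+ t 20000^90≤10^391) (≤⇒+≤+ t 7≤10^391)
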